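{- Let $G$ be a finite simple connected graph with diameter $D$. Then the following statements are equivalent: (a) $G$ is distance-regular. (b) $G$ is $D$-cospectral. (c) $G$ is $D$-isospectral.
   Context: $\partial(u,v)$ denotes the distance between vertices $u,v$, and $\operatorname{sp}$ denotes the spectrum (eigenvalues with multiplicities) of the adjacency matrix of a graph or pseudograph (a graph possibly with loops and multiple edges). Let $A=(a_{xy})$ be the adjacency matrix of $G$. Distance-regular has its standard meaning: for all $i,j,k$, the number of vertices at distance $i$ from $u$ and at distance $j$ from $v$ depends only on $i,j$ and $k=\partial(u,v)$. For $0\le h\le D$: - $G$ is $h$-punctually cospectral if $\operatorname{sp}(G-u-v)=\operatorname{sp}(G-w-z)$ for all pairs of vertices $u,v$ and $w,z$ with $\partial(u,v)=\partial(w,z)=h$, where $G-u-v$ is obtained from $G$ by removing the vertices in $\{u,v\}$ and all incident edges (for $h=0$ this is $G-u$). - For $h\ge 1$, $G$ is $h$-punctually isospectral if, for all pairs of vertices $u,v$ and $w,z$ with $\partial(u,v)=\partial(w,z)=h$, at least one of the following holds: $\operatorname{sp}(G\pm uv)=\operatorname{sp}(G\pm wz)$; $\operatorname{sp} G_{u+v}=\operatorname{sp} G_{w+z}$; $\operatorname{sp}(G+u\bar u v)=\operatorname{sp}(G+w\bar w z)$. For $h=0$, flipping $uu$ means adding a loop at $u$, and $G$ is $0$-punctually isospectral if $\operatorname{sp}(G+uu)=\operatorname{sp}(G+ww)$ for all vertices $u,w$, where $G+uu$ has adjacency matrix $A$ with the $uu$-entry changed to $1$. Here, for distinct $u,v$: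 $G\pm uv$ is obtained from $G$ by flipping $uv$ (deleting the edge $uv$ if present, adding it otherwise); $G_{u+v}$ is the pseudograph obtained by amalgamating $u$ and $v$ into one new vertex $u+v$ (adjacencies among other vertices are unchanged, the adjacency-matrix entry for $u+v$ and another vertex $x$ is $a_{ux}+a_{vx}$, and the diagonal entry at $u+v$ is $a_{uv}$); $G+u\bar u v$ is obtained by adding a new vertex $\bar u$ adjacent exactly to $u$ and $v$. $G$ is $D$-cospectral (respectively $D$-isospectral) if it is $i$-punctually cospectral (respectively $i$-punctually isospectral) for every $0\le i\le D$. -}

module Defs where

open import Algebra.Apartness.Bundles using (HeytingCommutativeRing; HeytingField)
open import Algebra.Bundles using (CommutativeRing; RawRing)
import Algebra.Definitions.RawMonoid as RawMonoidDefs
import Algebra.Definitions.RawSemiring as RawSemiringDefs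
open import Data.Bool.Base using (Bool; true; false; not; if_then_else_; T)
open import Data.Bool.Properties using (T?)
open import Data.Fin.Base using (Fin; zero; suc; toℕ; punchIn)
open import Data.Fin.Properties using (_≟_; any?)
open import Data.Integer.Base using (ℤ; +_; -[1+_]; +-*-rawRing; 0ℤ; 1ℤ)
import Data.Integer.Base as ℤ
open import Data.List.Base using (List; []; _∷_; [_]; _++_; map; foldr; filter; length; lookup; allFin)
open import Data.Nat.Base using (ℕ; zero; suc; _≤_; z≤n; s≤s)
import Data.Nat.Properties as ℕ
open import Data.Product.Base using (∃; ∃₂; _×_; _,_; proj₁)
open import Data.Sum.Base using (_⊎_)
open import Level using (_⊔_) renaming (suc to lsuc)
open import Relation.Binary.PropositionalEquality.Core using (_≡_; refl)
open import Relation.Nullary.Decidable using (yes; no; does; ¬?; map′; _×-dec_; _⊎-dec_)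
open import Relation.Nullary.Negation.Core using (contradiction)
open import Relation.Unary using (Decidable)

------------------------------------------------------------------------
-- Determinants and polynomials

Matrix : ∀ {a} → Set a → ℕ → Set a
Matrix A n = Fin n → Fin n → A

module _ {c ℓ} (R : RawRing c ℓ) where
  open RawRing R
  open RawSemiringDefs rawSemiring using (sum; _^_)

  -- Laplace expansion along the first row.
  det : ∀ {n} → Matrix Carrier n → Carrier
  det {zero}  M = 1#
  det {suc n} M = sum λ j →
    ((- 1#) ^ toℕ j) * (M zero j * det (λ i k → M (suc i) (punchIn j k)))

-- A polynomial is its list of coefficients, constant term first.  Trailing
-- zeros are allowed, so equality is equality of all coefficients.
module Polynomial {c ℓ} (R : RawRing c ℓ) where
  open RawRing R

  Poly : Set c
  Poly = List Carrier

  coeff : Poly → ℕ → Carrier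
  coeff []      _       = 0#
  coeff (a ∷ p) zero    = a
  coeff (a ∷ p) (suc i) = coeff p i

  infix  4 _≈ᴾ_
  infixl 6 _+ᴾ_
  infixl 7 _*ᴾ_

  _≈ᴾ_ : Poly → Poly → Set ℓ
  p ≈ᴾ q = ∀ i → coeff p i ≈ coeff q i

  _+ᴾ_ : Poly → Poly → Poly
  []      +ᴾ q       = q
  (a ∷ p) +ᴾ []      = a ∷ p
  (a ∷ p) +ᴾ (b ∷ q) = (a + b) ∷ (p +ᴾ q)

  _*ᴾ_ : Poly → Poly → Poly
  []      *ᴾ q = []
  (a ∷ p) *ᴾ q = map (a *_) q +ᴾ (0# ∷ (p *ᴾ q))

  -ᴾ_ : Poly → Poly
  -ᴾ_ = map (-_)

  -- The linear polynomial X − a.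
  X-_ : Carrier → Poly
  X- a = (- a) ∷ 1# ∷ []

  eval : Poly → Carrier → Carrier
  eval []      x = 0#
  eval (a ∷ p) x = a + x * eval p x

  polyRawRing : RawRing c ℓ
  polyRawRing = record
    { Carrier = Poly
    ; _≈_     = _≈ᴾ_
    ; _+_     = _+ᴾ_
    ; _*_     = _*ᴾ_
    ; -_      = -ᴾ_
    ; 0#      = []
    ; 1#      = [ 1# ]
    }

-- det (X I − M)
charPoly : ∀ {n} → Matrix ℤ n → List ℤ
charPoly M = det polyRawRing λ i j →
  if does (i ≟ j) then X- (M i j) else [ ℤ.- (M i j) ]
  where open Polynomial +-*-rawRing

------------------------------------------------------------------------
-- Spectra

module _ {c ℓ₁ ℓ₂} (F : HeytingField c ℓ₁ ℓ₂) where
  open HeytingField F using (heytingCommutativeRing)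
  open HeytingCommutativeRing heytingCommutativeRing using (commutativeRing)

  fieldRawRing : RawRing c ℓ₁
  fieldRawRing = CommutativeRing.rawRing commutativeRing

-- The field in which eigenvalues are taken, for instance ℂ (the library has
-- neither ℝ nor ℂ).  Equality on the field is not assumed to be decidable.
record AlgClosedFieldChar0 c ℓ₁ ℓ₂ : Set (lsuc (c ⊔ ℓ₁ ⊔ ℓ₂)) where
  field
    heytingField : HeytingField c ℓ₁ ℓ₂

  open HeytingField heytingField public using (Carrier; _≈_; _#_; 0#; 1#)

  rawRing : RawRing c ℓ₁
  rawRing = fieldRawRing heytingField

  open RawRing rawRing public using (+-rawMonoid; -_)
  open RawMonoidDefs +-rawMonoid public using () renaming (_×_ to _·_)
  open Polynomial rawRing public using (Poly; _≈ᴾ_; _*ᴾ_; X-_; eval)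

  field
    charZero : ∀ n → (suc n · 1#) # 0#

    -- b + … + a X^d with d ≥ 1 and a ≠ 0
    algClosed : ∀ b (p : Poly) a → a # 0# →
                ∃ λ x → eval (b ∷ p ++ [ a ]) x ≈ 0#

  fromℤ : ℤ → Carrier
  fromℤ (+ n)    = n · 1#
  fromℤ -[1+ n ] = - (suc n · 1#)

module _ {c ℓ₁ ℓ₂} (K : AlgClosedFieldChar0 c ℓ₁ ℓ₂) where
  open AlgClosedFieldChar0 K

  -- The list θs enumerates the eigenvalues of M, each repeated according to
  -- its multiplicity.
  IsSpectrum : ∀ {n} → Matrix ℤ n → List Carrier → Set ℓ₁
  IsSpectrum M θs =
    map fromℤ (charPoly M) ≈ᴾ foldr (λ θ p → (X- θ) *ᴾ p) [ 1# ] θs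

  -- sp M = sp N: two multisets are equal iff some list enumerates both.
  SameSpectrum : ∀ {m n} → Matrix ℤ m → Matrix ℤ n → Set (c ⊔ ℓ₁)
  SameSpectrum M N = ∃ λ θs → IsSpectrum M θs × IsSpectrum N θs

------------------------------------------------------------------------
-- Graphs and distance

record Graph (n : ℕ) : Set where
  field
    adj    : Fin n → Fin n → Bool
    sym    : ∀ u v → adj u v ≡ adj v u
    irrefl : ∀ v → adj v v ≡ false

leastFrom : ∀ {p} {P : ℕ → Set p} → Decidable P → ∀ m → P m →
            ∃ λ k → P k × (∀ j → P j → k ≤ j)
leastFrom P? m pm with P? zero
... | yes p₀ = zero , p₀ , λ _ _ → z≤n
leastFrom P? zero pm | no ¬p₀ = contradiction pm ¬p₀
leastFrom P? (suc m) pm | no ¬p₀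
  with leastFrom (λ k → P? (suc k)) m pm
... | k , pk , min = suc k , pk , λ where
  zero    p₀ → contradiction p₀ ¬p₀
  (suc j) pj → s≤s (min j pj)

least : ∀ {p} {P : ℕ → Set p} → Decidable P → ∃ P →
        ∃ λ k → P k × (∀ j → P j → k ≤ j)
least P? (m , pm) = leastFrom P? m pm

module _ {n} (G : Graph n) where
  open Graph G

  data Walk : Fin n → Fin n → ℕ → Set where
    []  : ∀ {v} → Walk v v zero
    _∷_ : ∀ {u w v k} → T (adj u w) → Walk w v k → Walk u v (suc k)

  walk? : ∀ u v → Decidable (Walk u v)
  walk? u v zero = map′ (λ where refl → []) (λ where [] → refl) (u ≟ v)
  walk? u v (suc k) =
    map′ (λ where (_ , a , p) → a ∷ p) (λ where (a ∷ p) → _ , a , p)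
         (any? λ w → T? (adj u w) ×-dec walk? w v k)

  Connected : Set
  Connected = ∀ u v → ∃ (Walk u v)

module _ {n} (G : Graph n) (conn : Connected G) where

  ∂ : Fin n → Fin n → ℕ
  ∂ u v = proj₁ (least (walk? G u v) (conn u v))

  IsDiameter : ℕ → Set
  IsDiameter D = (∀ u v → ∂ u v ≤ D) × (∃₂ λ u v → ∂ u v ≡ D)

  -- The number of vertices at distance i from u and at distance j from v.
  countAt : ℕ → ℕ → Fin n → Fin n → ℕ
  countAt i j u v =
    length (filter (λ x → (∂ u x ℕ.≟ i) ×-dec (∂ v x ℕ.≟ j)) (allFin n))

  DistanceRegular : Set
  DistanceRegular = ∀ i j k u v w z → ∂ u v ≡ k → ∂ w z ≡ k →
                    countAt i j u v ≡ countAt i j w z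

------------------------------------------------------------------------
-- Perturbations of a graph, given by the adjacency matrices of the
-- resulting (pseudo)graphs

bit : Bool → ℤ
bit b = if b then 1ℤ else 0ℤ

-- The matrix M with a new first row and column b and corner entry d.
bordered : ∀ {n} → ℤ → (Fin n → ℤ) → Matrix ℤ n → Matrix ℤ (suc n)
bordered d b M zero    zero    = d
bordered d b M zero    (suc y) = b y
bordered d b M (suc x) zero    = b x
bordered d b M (suc x) (suc y) = M x y

-- The vertices outside {u , v}; here u and v may coincide.
others : ∀ {n} → Fin n → Fin n → List (Fin n)
others {n} u v = filter (λ x → ¬? (x ≟ u) ×-dec ¬? (x ≟ v)) (allFin n)

module _ {n} (G : Graph n) where
  open Graph G

  adjacency : Matrix ℤ n
  adjacency x y = bit (adj x y)

  -- G − u − v, which is G − u when u = v.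
  remove : (u v : Fin n) → Matrix ℤ (length (others u v))
  remove u v i j =
    adjacency (lookup (others u v) i) (lookup (others u v) j)

  -- G + uu
  addLoop : Fin n → Matrix ℤ n
  addLoop u x y =
    if does ((x ≟ u) ×-dec (y ≟ u)) then 1ℤ else adjacency x y

  -- G ± uv for u ≠ v
  flip : (u v : Fin n) → Matrix ℤ n
  flip u v x y =
    if does (((x ≟ u) ×-dec (y ≟ v)) ⊎-dec ((x ≟ v) ×-dec (y ≟ u)))
    then bit (not (adj x y)) else bit (adj x y)

  -- G_{u+v} for u ≠ v; the new vertex u + v comes first.
  amalgamate : (u v : Fin n) → Matrix ℤ (suc (length (others u v)))
  amalgamate u v = bordered (adjacency u v)
    (λ i → let x = lookup (others u v) i in adjacency u x ℤ.+ adjacency v x)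
    (remove u v)

  -- G + u ū v for u ≠ v; the new vertex ū comes first.
  addPath : (u v : Fin n) → Matrix ℤ (suc n)
  addPath u v = bordered 0ℤ
    (λ x → bit (does ((x ≟ u) ⊎-dec (x ≟ v))))
    adjacency

------------------------------------------------------------------------
-- Cospectrality and isospectrality

module _ {c ℓ₁ ℓ₂} (K : AlgClosedFieldChar0 c ℓ₁ ℓ₂)
         {n} (G : Graph n) (conn : Connected G) where

  PunctuallyCospectral : ℕ → Set (c ⊔ ℓ₁)
  PunctuallyCospectral h = ∀ u v w z → ∂ G conn u v ≡ h → ∂ G conn w z ≡ h →
    SameSpectrum K (remove G u v) (remove G w z)

  PunctuallyIsospectral : ℕ → Set (c ⊔ ℓ₁)
  PunctuallyIsospectral zero =
    ∀ u w → SameSpectrum K (addLoop G u) (addLoop G w)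
  PunctuallyIsospectral h@(suc _) =
    ∀ u v w z → ∂ G conn u v ≡ h → ∂ G conn w z ≡ h →
      SameSpectrum K (flip G u v) (flip G w z)
    ⊎ SameSpectrum K (amalgamate G u v) (amalgamate G w z)
    ⊎ SameSpectrum K (addPath G u v) (addPath G w z)

  CospectralUpTo : ℕ → Set (c ⊔ ℓ₁)
  CospectralUpTo D = ∀ i → i ≤ D → PunctuallyCospectral i

  IsospectralUpTo : ℕ → Set (c ⊔ ℓ₁)
  IsospectralUpTo D = ∀ i → i ≤ D → PunctuallyIsospectral i

{-# OPTIONS --safe #-}
module Submission where

-- Put B = I − tA over ℤ⟦t⟧.  Its inverse C has entries C u v = Σₖ (Aᵏ)ᵤᵥ tᵏ, and
-- det B is the reversed characteristic polynomial, so that equality of spectra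
-- becomes equality of such determinants.  Removing u, or adding a loop at u,
-- changes det B by a factor that determines C u u; once all diagonal entries
-- of C are equal to p, each perturbation of a pair u ≠ v changes det B by a
-- factor F(C u v) depending only on p, F and the adjacency of u and v.  In each
-- case F(x) − F(y) = s (y − x) with s ≠ 0 whenever x and y are the entries at
-- two pairs of vertices at the same positive distance; for the removal of two
-- vertices s = x + y, which is nonzero because walk counts are nonnegative.
-- Hence both (b) and (c) say that the number of walks of each length from u to
-- v depends only on ∂(u, v).  For a distance-regular graph this follows by
-- induction on the length.  Conversely Aᵏ is then a combination of the
-- distance matrices A₀, …, Aₖ with nonzero coefficient at Aₖ, so all Aₕ lie in
-- the algebra spanned by the powers of A, and the entries of AᵢAⱼ, which are
-- the intersection numbers, depend only on the distance.

open import Defs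
open import Algebra.Apartness.Bundles using (HeytingCommutativeRing; HeytingField)
open import Algebra.Bundles using (CommutativeRing; RawRing; Semiring)
import Algebra.Definitions.RawSemiring
open import Algebra.Morphism.Structures using (IsRingHomomorphism)
import Algebra.Solver.Ring
open import Data.Bool.Base using (true; false; not; if_then_else_; T; _∧_; _∨_)
open import Data.Bool.Properties using (T-≡)
open import Data.Fin.Base using (Fin; zero; suc; toℕ; punchIn; punchOut)
open import Data.Fin.Patterns using (0F; 1F)
open import Data.Fin.Permutation using (Permutation; _⟨$⟩ʳ_; permutation; ↔⇒≡)
open import Data.Fin.Properties using (_≟_; any?; toℕ<n; punchIn-punchOut; punchOut-injective; suc-injective; 0≢1+n)
open import Data.Integer.Base as ℤ using (ℤ; +_; -[1+_]; 0ℤ; 1ℤ; +-*-rawRing)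
import Data.Integer.Properties as ℤₚ
open import Data.List.Base as List
  using (List; []; _∷_; [_]; _++_; map; foldr; filter; length; lookup; tabulate; allFin; applyUpTo)
open import Data.List.Membership.Propositional using (_∈_)
open import Data.List.Membership.Propositional.Properties using (∈-lookup; ∈-filter⁺; ∈-allFin)
open import Data.List.Relation.Unary.All as All using (All; []; _∷_)
open import Data.List.Relation.Unary.All.Properties using (all-filter)
open import Data.List.Relation.Unary.AllPairs using ([]; _∷_)
open import Data.List.Relation.Unary.Any as Any using (here; there)
open import Data.List.Relation.Unary.Any.Properties using (lookup-index)
open import Data.List.Relation.Unary.Unique.Propositional using (Unique)
open import Data.List.Relation.Unary.Unique.Propositional.Properties using (filter⁺; allFin⁺)
import Data.Maybe.Base as Maybe
open import Data.Nat.Base as ℕ using (ℕ; zero; suc; _<_; _≤_; s≤s; z≤n)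
open import Data.Nat.Induction using (<-rec)
import Data.Nat.Properties as ℕₚ
open import Data.Product.Base using (∃; _×_; _,_; proj₁; proj₂)
open import Data.Sum.Base using (inj₁; inj₂)
open import Data.Vec.Functional using (tail) renaming (_∷_ to infixr 5 _◁_)
open import Function.Base using (_∘_; id)
open import Function.Bundles using (_⇔_; mk⇔; Equivalence; Injection)
open import Function.Definitions using (Injective)
open import Function.Properties.Inverse using (Inverse⇒Injection)
open import Relation.Binary.Definitions using (tri<; tri≈; tri>)
open import Relation.Binary.PropositionalEquality as ≡ using (_≡_; _≢_)
open import Relation.Nullary.Decidable
  using (Dec; does; yes; no; ¬?; _×-dec_; _⊎-dec_; dec⇒maybe; dec-true; dec-false; does-⇔)
open import Relation.Nullary.Negation.Core using (contradiction; ¬_)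
open import Relation.Unary using (Decidable)

-- The image of ℤ in a commutative ring

-- Eigenvalues serve only to pass between spectra and characteristic polynomials: injectivity of ℤ →
-- K compares coefficients, and algebraic closure provides a list of roots for a monic polynomial.
-- No equality in K is ever decided; everything else happens over ℤ and ℤ⟦t⟧.
--
-- Reversal is what makes the matrix invertible: I - tA has determinant with constant term 1 and an
-- inverse over ℤ⟦t⟧, whereas x I - A has none over ℤ[x]. The perturbed determinants are then
-- obtained from CB = I by row operations, without division.
--
-- A power series cannot be tested for being zero, so cancelling s requires its order and a nonzero
-- coefficient there. Hence the explicit orders further on: 0, 1 or 2 for most multipliers, and ∂(u,
-- v) for the removal of two vertices.
--
-- In (c) the kind of perturbation may change from one choice of two pairs to the next. Each kind
-- alone must therefore determine the entry of C, by comparing just two pairs at a time.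

module IntegerImage {c ℓ} (R : CommutativeRing c ℓ) where
  open CommutativeRing R
  open import Algebra.Properties.Ring ring using (-‿involutive; -0#≈0#; -‿+-comm; -‿distribˡ-*; -‿distribʳ-*; xyx⁻¹≈y)
  open import Algebra.Properties.Semiring.Mult semiring using (×-homo-+; ×1-homo-*) renaming (_×_ to _·_)
  open import Relation.Binary.Reasoning.Setoid setoid

  ⟦_⟧ℤ : ℤ → Carrier
  ⟦ + n ⟧ℤ      = n · 1#
  ⟦ -[1+ n ] ⟧ℤ = - (suc n · 1#)

  ⟦⊖⟧ : ∀ m n → ⟦ m ℤ.⊖ n ⟧ℤ ≈ m · 1# - n · 1#
  ⟦⊖⟧ zero zero = sym (-‿inverseʳ _)
  ⟦⊖⟧ zero (suc n) = sym (+-identityˡ _)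
  ⟦⊖⟧ (suc m) zero = sym (trans (+-congˡ -0#≈0#) (+-identityʳ _))
  ⟦⊖⟧ (suc m) (suc n) = begin
    ⟦ suc m ℤ.⊖ suc n ⟧ℤ                     ≡⟨ ≡.cong ⟦_⟧ℤ (ℤₚ.[1+m]⊖[1+n]≡m⊖n m n) ⟩
    ⟦ m ℤ.⊖ n ⟧ℤ                             ≈⟨ ⟦⊖⟧ m n ⟩
    m · 1# - n · 1#                          ≈⟨ +-congʳ (xyx⁻¹≈y 1# (m · 1#)) ⟨
    1# + m · 1# - 1# - n · 1#                ≈⟨ +-assoc _ _ _ ⟩
    1# + m · 1# + (- 1# - n · 1#)            ≈⟨ +-congˡ (-‿+-comm _ _) ⟩
    suc m · 1# - suc n · 1#                  ∎

  ⟦-⟧ : ∀ i → ⟦ ℤ.- i ⟧ℤ ≈ - ⟦ i ⟧ℤ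
  ⟦-⟧ (+ zero)    = sym -0#≈0#
  ⟦-⟧ (+ (suc n)) = refl
  ⟦-⟧ -[1+ n ]    = sym (-‿involutive _)

  ⟦+⟧ : ∀ i j → ⟦ i ℤ.+ j ⟧ℤ ≈ ⟦ i ⟧ℤ + ⟦ j ⟧ℤ
  ⟦+⟧ (+ m) (+ n) = ×-homo-+ 1# m n
  ⟦+⟧ (+ m) -[1+ n ] = ⟦⊖⟧ m (suc n)
  ⟦+⟧ -[1+ m ] (+ n) = trans (⟦⊖⟧ n (suc m)) (+-comm _ _)
  ⟦+⟧ -[1+ m ] -[1+ n ] = begin
    - (suc (suc (m ℕ.+ n)) · 1#)        ≡⟨ ≡.cong (λ k → - (suc k · 1#)) (ℕₚ.+-suc m n) ⟨
    - ((suc m ℕ.+ suc n) · 1#)          ≈⟨ -‿cong (×-homo-+ 1# (suc m) (suc n)) ⟩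
    - (suc m · 1# + suc n · 1#)         ≈⟨ -‿+-comm _ _ ⟨
    - (suc m · 1#) - suc n · 1#         ∎

  ⟦*⟧⁺ : ∀ m j → ⟦ + m ℤ.* j ⟧ℤ ≈ m · 1# * ⟦ j ⟧ℤ
  ⟦*⟧⁺ m (+ n) = begin
    ⟦ + m ℤ.* + n ⟧ℤ   ≡⟨ ≡.cong ⟦_⟧ℤ (ℤₚ.pos-* m n) ⟨
    (m ℕ.* n) · 1#     ≈⟨ ×1-homo-* m n ⟩
    m · 1# * (n · 1#)  ∎
  ⟦*⟧⁺ m -[1+ n ] = begin
    ⟦ + m ℤ.* -[1+ n ] ⟧ℤ       ≡⟨ ≡.cong ⟦_⟧ℤ (ℤₚ.neg-distribʳ-* (+ m) (+ suc n)) ⟨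
    ⟦ ℤ.- (+ m ℤ.* + suc n) ⟧ℤ  ≈⟨ ⟦-⟧ (+ m ℤ.* + suc n) ⟩
    - ⟦ + m ℤ.* + suc n ⟧ℤ      ≈⟨ -‿cong (⟦*⟧⁺ m (+ suc n)) ⟩
    - (m · 1# * (suc n · 1#))   ≈⟨ -‿distribʳ-* _ _ ⟩
    m · 1# * - (suc n · 1#)     ∎

  ⟦*⟧ : ∀ i j → ⟦ i ℤ.* j ⟧ℤ ≈ ⟦ i ⟧ℤ * ⟦ j ⟧ℤ
  ⟦*⟧ (+ m) j = ⟦*⟧⁺ m j
  ⟦*⟧ -[1+ m ] j = begin
    ⟦ -[1+ m ] ℤ.* j ⟧ℤ         ≡⟨ ≡.cong ⟦_⟧ℤ (ℤₚ.neg-distribˡ-* (+ suc m) j) ⟨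
    ⟦ ℤ.- (+ suc m ℤ.* j) ⟧ℤ    ≈⟨ ⟦-⟧ (+ suc m ℤ.* j) ⟩
    - ⟦ + suc m ℤ.* j ⟧ℤ        ≈⟨ -‿cong (⟦*⟧⁺ (suc m) j) ⟩
    - (suc m · 1# * ⟦ j ⟧ℤ)     ≈⟨ -‿distribˡ-* _ _ ⟩
    - (suc m · 1#) * ⟦ j ⟧ℤ     ∎

  open import Algebra.Solver.Ring.AlmostCommutativeRing
    using (AlmostCommutativeRing; fromCommutativeRing; _-Raw-AlmostCommutative⟶_)

  almostCommutativeRing : AlmostCommutativeRing c ℓ
  almostCommutativeRing = fromCommutativeRing R

  -- Agrees with ⟦_⟧ℤ, but con 1ℤ in a solver equation then denotes 1#
  -- rather than 1# + 0#.
  ⟦_⟧₁ : ℤ → Carrier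
  ⟦ + 1 ⟧₁ = 1#
  ⟦ i   ⟧₁ = ⟦ i ⟧ℤ

  ⟦⟧₁≈⟦⟧ℤ : ∀ i → ⟦ i ⟧₁ ≈ ⟦ i ⟧ℤ
  ⟦⟧₁≈⟦⟧ℤ (+ 0)           = refl
  ⟦⟧₁≈⟦⟧ℤ (+ 1)           = sym (+-identityʳ 1#)
  ⟦⟧₁≈⟦⟧ℤ (+ suc (suc n)) = refl
  ⟦⟧₁≈⟦⟧ℤ -[1+ n ]        = refl

  morphism : +-*-rawRing -Raw-AlmostCommutative⟶ almostCommutativeRing
  morphism = record
    { ⟦_⟧    = ⟦_⟧₁
    ; +-homo = λ i j → trans (⟦⟧₁≈⟦⟧ℤ (i ℤ.+ j)) (trans (⟦+⟧ i j) (sym (+-cong (⟦⟧₁≈⟦⟧ℤ i) (⟦⟧₁≈⟦⟧ℤ j))))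
    ; *-homo = λ i j → trans (⟦⟧₁≈⟦⟧ℤ (i ℤ.* j)) (trans (⟦*⟧ i j) (sym (*-cong (⟦⟧₁≈⟦⟧ℤ i) (⟦⟧₁≈⟦⟧ℤ j))))
    ; -‿homo = λ i → trans (⟦⟧₁≈⟦⟧ℤ (ℤ.- i)) (trans (⟦-⟧ i) (-‿cong (sym (⟦⟧₁≈⟦⟧ℤ i))))
    ; 0-homo = refl
    ; 1-homo = refl
    }

  -- Coefficients are integers because normalisation has to recognise equal coefficients, and
  -- equality in `R` need not be decidable.
  module Solver = Algebra.Solver.Ring +-*-rawRing almostCommutativeRing morphism
    (λ i j → Maybe.map (λ i≡j → reflexive (≡.cong ⟦_⟧₁ i≡j)) (dec⇒maybe (i ℤₚ.≟ j)))

-- Determinants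

module Determinant {c ℓ} (R : CommutativeRing c ℓ) where
  open CommutativeRing R hiding (zero)
  open IntegerImage R using (module Solver)
  open Solver using (solve; _:=_; _:+_; _:*_; _:-_; :-_)
  open import Algebra.Properties.Ring ring
    using (-1*x≈-x; -‿distribˡ-*; -0#≈0#)
  open import Algebra.Properties.Semiring.Sum semiring
    using (sum; sum-cong-≋; ∑-distrib-+; ∑-comm; *-distribˡ-sum; sum-replicate-zero; sum-permute)
  open import Relation.Binary.Reasoning.Setoid setoid
  open import Algebra.Definitions.RawSemiring (Semiring.rawSemiring semiring) using (_^_)

  private
    Mat : ℕ → Set c
    Mat = Matrix Carrier

    variable
      m n : ℕ

  -- ∑, sgn and Det are opaque because unification would otherwise unfold the
  -- underlying recursions and fail to solve implicit arguments.
  opaque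
    ∑ : (Fin n → Carrier) → Carrier
    ∑ = sum

    ∑-cong : ∀ {f g : Fin n → Carrier} → (∀ i → f i ≈ g i) → ∑ f ≈ ∑ g
    ∑-cong = sum-cong-≋

    ∑-suc : ∀ (f : Fin (suc n) → Carrier) → ∑ f ≈ f zero + ∑ λ i → f (suc i)
    ∑-suc f = refl

    ∑-zero : ∀ {f : Fin n → Carrier} → (∀ i → f i ≈ 0#) → ∑ f ≈ 0#
    ∑-zero {n} f≈0 = trans (sum-cong-≋ f≈0) (sum-replicate-zero n)

    ∑-+ : ∀ (f g : Fin n → Carrier) → ∑ (λ i → f i + g i) ≈ ∑ f + ∑ g
    ∑-+ = ∑-distrib-+

    ∑-swap : ∀ (f : Fin m → Fin n → Carrier) → ∑ (λ i → ∑ λ j → f i j) ≈ ∑ λ j → ∑ λ i → f i j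
    ∑-swap = ∑-comm

    *-distribˡ-∑ : ∀ x (f : Fin n → Carrier) → x * ∑ f ≈ ∑ λ i → x * f i
    *-distribˡ-∑ = *-distribˡ-sum

    ∑-permute : ∀ (f : Fin n → Carrier) (π : Permutation m n) → ∑ f ≈ ∑ λ i → f (π ⟨$⟩ʳ i)
    ∑-permute = sum-permute

  ∑-neg : ∀ (f : Fin n → Carrier) → ∑ (λ i → - f i) ≈ - ∑ f
  ∑-neg f = begin
    ∑ (λ i → - f i)        ≈⟨ ∑-cong (λ i → -1*x≈-x (f i)) ⟨
    ∑ (λ i → - 1# * f i)   ≈⟨ *-distribˡ-∑ (- 1#) f ⟨
    - 1# * ∑ f             ≈⟨ -1*x≈-x _ ⟩
    - ∑ f                  ∎

  ∑-supported₀ : ∀ {f : Fin (suc n) → Carrier} → (∀ i → f (suc i) ≈ 0#) → ∑ f ≈ f zero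
  ∑-supported₀ {f = f} f≈0 = trans (∑-suc f) (trans (+-congˡ (∑-zero f≈0)) (+-identityʳ _))

  opaque
    sgn : Fin n → Carrier
    sgn j = (- 1#) ^ toℕ j

    sgn-zero : sgn (zero {n}) ≈ 1#
    sgn-zero = refl

    sgn-suc : ∀ (j : Fin n) → sgn (suc j) ≈ - sgn j
    sgn-suc j = -1*x≈-x (sgn j)

  sgn² : ∀ (j : Fin n) → sgn j * sgn j ≈ 1#
  sgn² zero    = trans (*-cong sgn-zero sgn-zero) (*-identityˡ 1#)
  sgn² (suc j) = trans (*-cong (sgn-suc j) (sgn-suc j))
    (trans (solve 1 (λ s → :- s :* :- s := s :* s) refl (sgn j)) (sgn² j))

  minor : (Fin m → Fin (suc n) → Carrier) → Fin (suc n) → Fin m → Fin n → Carrier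
  minor M j i k = M i (punchIn j k)

  opaque
    unfolding ∑ sgn

    Det : Mat n → Carrier
    Det = det rawRing

    det≡Det : ∀ (M : Mat n) → det rawRing M ≡ Det M
    det≡Det M = ≡.refl

    Det-zero : ∀ (M : Mat 0) → Det M ≈ 1#
    Det-zero M = refl

    Det-expand : ∀ (M : Mat (suc n)) → Det M ≈ ∑ λ j → sgn j * (M zero j * Det (minor (tail M) j))
    Det-expand M = refl

  det-cong : ∀ {M N : Mat n} → (∀ i j → M i j ≈ N i j) → Det M ≈ Det N
  det-cong {zero} {M} {N} M≈N = trans (Det-zero M) (sym (Det-zero N))
  det-cong {suc n} {M} {N} M≈N = trans (Det-expand M) (trans
    (∑-cong λ j → *-congˡ (*-cong (M≈N zero j) (det-cong λ i k → M≈N (suc i) (punchIn j k))))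
    (sym (Det-expand N)))

  -- Carries an operation on the lower rows through the expansion along an untouched first row; this
  -- works because the factor `s` is the same for all minors.
  det-expand-cong : ∀ {M N : Mat (suc n)} s → (∀ j → M zero j ≈ N zero j) →
                    (∀ j → Det (minor (tail M) j) ≈ s * Det (minor (tail N) j)) →
                    Det M ≈ s * Det N
  det-expand-cong {M = M} {N} s row minors = begin
    Det M
      ≈⟨ Det-expand M ⟩
    ∑ (λ j → sgn j * (M zero j * Det (minor (tail M) j)))
      ≈⟨ ∑-cong (λ j → trans (*-congˡ (*-cong (row j) (minors j)))
           (solve 4 (λ g a s d → g :* (a :* (s :* d)) := s :* (g :* (a :* d)))
                    refl (sgn j) (N zero j) s _)) ⟩
    ∑ (λ j → s * (sgn j * (N zero j * Det (minor (tail N) j))))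
      ≈⟨ *-distribˡ-∑ s _ ⟨
    s * ∑ (λ j → sgn j * (N zero j * Det (minor (tail N) j)))
      ≈⟨ *-congˡ (Det-expand N) ⟨
    s * Det N ∎

  det-minors-zero : ∀ {M : Mat (suc n)} → (∀ j → Det (minor (tail M) j) ≈ 0#) → Det M ≈ 0#
  det-minors-zero {M = M} minors = trans (Det-expand M)
    (∑-zero λ j → trans (*-congˡ (trans (*-congˡ (minors j)) (zeroʳ _))) (zeroʳ _))

  det-combination : ∀ (y : Fin m → Carrier) (r : Fin m → Fin (suc n) → Carrier) M →
                    Det ((λ j → ∑ λ k → y k * r k j) ◁ M) ≈ ∑ λ k → y k * Det (r k ◁ M)
  det-combination y r M = begin
    Det ((λ j → ∑ λ k → y k * r k j) ◁ M)
      ≈⟨ Det-expand _ ⟩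
    ∑ (λ j → sgn j * (∑ (λ k → y k * r k j) * Det (minor M j)))
      ≈⟨ ∑-cong (λ j → trans (solve 3 (λ s t d → s :* (t :* d) := (s :* d) :* t) refl _ _ _)
           (trans (*-distribˡ-∑ (sgn j * Det (minor M j)) _)
           (∑-cong λ k → solve 4 (λ s d y r → (s :* d) :* (y :* r) := y :* (s :* (r :* d)))
                                 refl (sgn j) _ (y k) (r k j)))) ⟩
    ∑ (λ j → ∑ λ k → y k * (sgn j * (r k j * Det (minor M j))))
      ≈⟨ ∑-swap (λ j k → y k * (sgn j * (r k j * Det (minor M j)))) ⟩
    ∑ (λ k → ∑ λ j → y k * (sgn j * (r k j * Det (minor M j))))
      ≈⟨ ∑-cong (λ k → trans (sym (*-distribˡ-∑ (y k) _)) (*-congˡ (sym (Det-expand (r k ◁ M))))) ⟩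
    ∑ (λ k → y k * Det (r k ◁ M)) ∎

  det-row-+ : ∀ {M N P : Mat (suc n)} → (∀ j → M zero j + N zero j ≈ P zero j) →
              (∀ i j → M (suc i) j ≈ P (suc i) j) → (∀ i j → N (suc i) j ≈ P (suc i) j) →
              Det M + Det N ≈ Det P
  det-row-+ {M = M} {N} {P} row M≈P N≈P = begin
    Det M + Det N
      ≈⟨ +-cong (Det-expand M) (Det-expand N) ⟩
    ∑ (λ j → sgn j * (M zero j * Det (minor (tail M) j))) +
    ∑ (λ j → sgn j * (N zero j * Det (minor (tail N) j)))
      ≈⟨ ∑-+ _ _ ⟨
    ∑ (λ j → sgn j * (M zero j * Det (minor (tail M) j)) + sgn j * (N zero j * Det (minor (tail N) j)))
      ≈⟨ ∑-cong (λ j → begin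
           sgn j * (M zero j * Det (minor (tail M) j)) + sgn j * (N zero j * Det (minor (tail N) j))
             ≈⟨ +-cong (*-congˡ (*-congˡ (det-cong λ i k → M≈P i (punchIn j k))))
                       (*-congˡ (*-congˡ (det-cong λ i k → N≈P i (punchIn j k)))) ⟩
           sgn j * (M zero j * Det (minor (tail P) j)) + sgn j * (N zero j * Det (minor (tail P) j))
             ≈⟨ solve 4 (λ s a b d → s :* (a :* d) :+ s :* (b :* d) := s :* ((a :+ b) :* d))
                        refl (sgn j) (M zero j) (N zero j) _ ⟩
           sgn j * ((M zero j + N zero j) * Det (minor (tail P) j))
             ≈⟨ *-congˡ (*-congʳ (row j)) ⟩
           sgn j * (P zero j * Det (minor (tail P) j)) ∎) ⟩
    ∑ (λ j → sgn j * (P zero j * Det (minor (tail P) j)))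
      ≈⟨ Det-expand P ⟨
    Det P ∎

  det-corner : ∀ {M : Mat (suc n)} → (∀ j → M zero (suc j) ≈ 0#) →
               Det M ≈ M zero zero * Det (λ i j → M (suc i) (suc j))
  det-corner {M = M} row = begin
    Det M
      ≈⟨ Det-expand M ⟩
    ∑ (λ j → sgn j * (M zero j * Det (minor (tail M) j)))
      ≈⟨ ∑-supported₀ (λ j → trans (*-congˡ (trans (*-congʳ (row j)) (zeroˡ _))) (zeroʳ _)) ⟩
    sgn zero * (M zero zero * Det (minor (tail M) zero))
      ≈⟨ trans (*-congʳ sgn-zero) (*-identityˡ _) ⟩
    M zero zero * Det (minor (tail M) zero) ∎

  -- The double expansion of a determinant along its first two rows x and y,
  -- with g giving the determinant of the remaining rows restricted to the
  -- columns picked out by its argument.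
  private
    pairSum : (x y : Fin (suc (suc n)) → Carrier) → ((Fin n → Fin (suc (suc n))) → Carrier) → Carrier
    pairSum x y g = ∑ λ j → sgn j * (x j * ∑ λ k → sgn k * (y (punchIn j k) * g (punchIn j ∘ punchIn k)))

    module PairSum (x y : Fin (suc (suc n)) → Carrier) (g : (Fin n → Fin (suc (suc n))) → Carrier) where
      edge : (Fin (suc (suc n)) → Carrier) → Carrier
      edge z = ∑ λ k → sgn k * (z (suc k) * g (suc ∘ punchIn k))

      inner : Fin (suc n) → Carrier
      inner j = ∑ λ k → sgn k * (y (suc (punchIn j k)) * g (punchIn (suc j) ∘ punchIn (suc k)))

      rest : Carrier
      rest = ∑ λ j → sgn j * (x (suc j) * inner j)

      row : Fin (suc (suc n)) → Carrier
      row j = ∑ λ k → sgn k * (y (punchIn j k) * g (punchIn j ∘ punchIn k))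

      row-suc : ∀ j → row (suc j) ≈ y zero * g (suc ∘ punchIn j) - inner j
      row-suc j = trans (∑-suc _) (+-cong (trans (*-congʳ sgn-zero) (*-identityˡ _)) (trans
        (∑-cong λ k → trans (*-congʳ (sgn-suc k)) (sym (-‿distribˡ-* _ _))) (∑-neg _)))

      -- The choices of two columns are sorted by the use of column zero: by `x`, by `y` (with a
      -- sign, as the column of `x` then lies to its right), or by neither. The last group is again
      -- a sum of the same kind with one column less, which drives the inductions below.
      pairSum-split : pairSum x y g ≈ x zero * edge y - y zero * edge x + rest
      pairSum-split = begin
        ∑ (λ j → sgn j * (x j * row j))
          ≈⟨ ∑-suc _ ⟩
        sgn zero * (x zero * row zero) + ∑ (λ j → sgn (suc j) * (x (suc j) * row (suc j)))
          ≈⟨ +-cong (trans (*-congʳ sgn-zero) (*-identityˡ _)) (∑-cong λ j →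
               trans (*-cong (sgn-suc j) (*-congˡ (row-suc j)))
               (solve 5 (λ s x y g t → :- s :* (x :* (y :* g :- t)) := :- y :* (s :* (x :* g)) :+ s :* (x :* t))
                        refl (sgn j) (x (suc j)) (y zero) (g (suc ∘ punchIn j)) (inner j))) ⟩
        x zero * edge y + ∑ (λ j → - y zero * (sgn j * (x (suc j) * g (suc ∘ punchIn j))) + sgn j * (x (suc j) * inner j))
          ≈⟨ +-congˡ (trans (∑-+ _ _) (+-congʳ (sym (*-distribˡ-∑ (- y zero) _)))) ⟩
        x zero * edge y + (- y zero * edge x + rest)
          ≈⟨ solve 4 (λ a b c r → a :+ (:- b :* c :+ r) := a :- b :* c :+ r) refl _ (y zero) _ _ ⟩
        x zero * edge y - y zero * edge x + rest ∎

    -- In `rest` neither of the first two rows takes column zero, so it stays among the columns of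
    -- the remaining rows, and `f` selects only from the others.
    under : ((Fin (suc m) → Fin (suc n)) → Carrier) → (Fin m → Fin n) → Carrier
    under g f = g λ { zero → zero ; (suc i) → suc (f i) }

    -- The selections on the two sides of `rest-suc` agree only pointwise, so `g` has to respect
    -- pointwise equality.
    Extensional : ((Fin m → Fin n) → Carrier) → Set ℓ
    Extensional g = ∀ {f f′} → (∀ i → f i ≡ f′ i) → g f ≈ g f′

    under-ext : ∀ {g : (Fin (suc m) → Fin (suc n)) → Carrier} → Extensional g → Extensional (under g)
    under-ext g-ext f≗f′ = g-ext λ { zero → ≡.refl ; (suc i) → ≡.cong suc (f≗f′ i) }

    rest-zero : ∀ (x y : Fin 2 → Carrier) g → PairSum.rest x y g ≈ 0#
    rest-zero x y g = ∑-zero λ j → trans (*-congˡ (trans (*-congˡ (∑-zero λ ())) (zeroʳ _))) (zeroʳ _)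

    rest-suc : ∀ (x y : Fin (suc (suc (suc n))) → Carrier) g → Extensional g →
               PairSum.rest x y g ≈ pairSum (x ∘ suc) (y ∘ suc) (under g)
    rest-suc x y g g-ext = ∑-cong λ j → *-congˡ (*-congˡ (∑-cong λ k → *-congˡ (*-congˡ
      (g-ext λ { zero → ≡.refl ; (suc i) → ≡.refl }))))

    pairSum-equal : ∀ (x : Fin (suc (suc n)) → Carrier) g → Extensional g → pairSum x x g ≈ 0#
    pairSum-equal x g g-ext = begin
      pairSum x x g                               ≈⟨ pairSum-split ⟩
      x zero * edge x - x zero * edge x + rest    ≈⟨ +-congʳ (-‿inverseʳ _) ⟩
      0# + rest                                   ≈⟨ +-identityˡ _ ⟩
      rest                                        ≈⟨ go x g g-ext ⟩
      0#                                          ∎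
      where
      open PairSum x x g
      go : ∀ {n} (x : Fin (suc (suc n)) → Carrier) g → Extensional g → PairSum.rest x x g ≈ 0#
      go {zero}  x g g-ext = rest-zero x x g
      go {suc n} x g g-ext = trans (rest-suc x x g g-ext)
        (pairSum-equal (x ∘ suc) (under g) (under-ext g-ext))

    pairSum-swap : ∀ (x y : Fin (suc (suc n)) → Carrier) g → Extensional g →
                   pairSum x y g ≈ - pairSum y x g
    pairSum-swap x y g g-ext = begin
      pairSum x y g                                 ≈⟨ PairSum.pairSum-split x y g ⟩
      x zero * edge y - y zero * edge x + rest      ≈⟨ +-congˡ (go x y g g-ext) ⟩
      x zero * edge y - y zero * edge x - rest′
        ≈⟨ solve 5 (λ a b c d r → a :* b :- c :* d :- r := :- (c :* d :- a :* b :+ r)) refl (x zero) _ (y zero) _ _ ⟩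
      - (y zero * edge x - x zero * edge y + rest′) ≈⟨ -‿cong (PairSum.pairSum-split y x g) ⟨
      - pairSum y x g                               ∎
      where
      open PairSum x y g
      open PairSum y x g using () renaming (rest to rest′)
      go : ∀ {n} (x y : Fin (suc (suc n)) → Carrier) g → Extensional g →
           PairSum.rest x y g ≈ - PairSum.rest y x g
      go {zero}  x y g g-ext = trans (rest-zero x y g) (sym (trans (-‿cong (rest-zero y x g)) -0#≈0#))
      go {suc n} x y g g-ext = trans (rest-suc x y g g-ext) (trans
        (pairSum-swap (x ∘ suc) (y ∘ suc) (under g) (under-ext g-ext))
        (-‿cong (sym (rest-suc y x g g-ext))))

    minors : (Fin n → Fin (suc (suc n)) → Carrier) → (Fin n → Fin (suc (suc n))) → Carrier
    minors M f = Det λ i k → M i (f k)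

    minors-ext : ∀ (M : Fin n → Fin (suc (suc n)) → Carrier) → Extensional (minors M)
    minors-ext M f≗f′ = det-cong λ i k → reflexive (≡.cong (M i) (f≗f′ k))

    det-pairSum : ∀ r s (M : Fin n → Fin (suc (suc n)) → Carrier) →
                  Det (r ◁ s ◁ M) ≈ pairSum r s (minors M)
    det-pairSum r s M = trans (Det-expand _) (∑-cong λ j → *-congˡ (*-congˡ (Det-expand _)))

  det-swap : ∀ r s (M : Fin n → Fin (suc (suc n)) → Carrier) → Det (r ◁ s ◁ M) ≈ - Det (s ◁ r ◁ M)
  det-swap r s M = trans (det-pairSum r s M) (trans
    (pairSum-swap r s (minors M) (minors-ext M)) (-‿cong (sym (det-pairSum s r M))))

  det-repeat₀ : ∀ r (M : Fin n → Fin (suc (suc n)) → Carrier) → Det (r ◁ r ◁ M) ≈ 0#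
  det-repeat₀ r M = trans (det-pairSum r r M) (pairSum-equal r (minors M) (minors-ext M))

  -- A swap puts row zero above the copy; each minor along row zero then starts with a copy of one
  -- of its own lower rows, one place closer.
  det-repeat : ∀ (M : Fin n → Fin (suc n) → Carrier) k → Det (M k ◁ M) ≈ 0#
  det-repeat M zero = trans
    (det-cong λ { zero _ → refl ; (suc zero) _ → refl ; (suc (suc i)) _ → refl })
    (det-repeat₀ (M zero) (tail M))
  det-repeat M (suc k) = begin
    Det (M (suc k) ◁ M)                      ≈⟨ det-cong (λ { zero _ → refl ; (suc zero) _ → refl ; (suc (suc i)) _ → refl }) ⟩
    Det (M (suc k) ◁ M zero ◁ tail M)        ≈⟨ det-swap (M (suc k)) (M zero) (tail M) ⟩
    - Det (M zero ◁ M (suc k) ◁ tail M)      ≈⟨ -‿cong (det-minors-zero λ j → trans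
                                                  (det-cong λ { zero _ → refl ; (suc i) _ → refl })
                                                  (det-repeat (minor (tail M) j) k)) ⟩
    - 0#                                     ≈⟨ -0#≈0# ⟩
    0#                                       ∎

  -- Every row of `M` except the first would occur twice, so only its coefficient `y zero` survives.
  det-row₀ : ∀ (y : Fin (suc n) → Carrier) (M : Mat (suc n)) →
             Det ((λ j → ∑ λ k → y k * M k j) ◁ tail M) ≈ y zero * Det M
  det-row₀ y M = begin
    Det ((λ j → ∑ λ k → y k * M k j) ◁ tail M)   ≈⟨ det-combination y M (tail M) ⟩
    ∑ (λ k → y k * Det (M k ◁ tail M))           ≈⟨ ∑-supported₀ (λ k → trans (*-congˡ (det-repeat (tail M) k)) (zeroʳ _)) ⟩
    y zero * Det (M zero ◁ tail M)                 ≈⟨ *-congˡ (det-cong λ { zero _ → refl ; (suc i) _ → refl }) ⟩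
    y zero * Det M                                 ∎

  -- Contributions of rows below the second vanish by repetition; what is left is the 2×2
  -- determinant of the coefficients at the first two rows.
  det-row₀₁ : ∀ (y z : Fin (suc (suc n)) → Carrier) (M : Mat (suc (suc n))) →
              Det ((λ j → ∑ λ k → y k * M k j) ◁ (λ j → ∑ λ k → z k * M k j) ◁ tail (tail M)) ≈
              (y zero * z (suc zero) - y (suc zero) * z zero) * Det M
  det-row₀₁ {n} y z M = begin
    Det (comb y ◁ comb z ◁ M″)
      ≈⟨ first y (comb z) ⟩
    y₀ * Det (r ◁ comb z ◁ M″) + y₁ * Det (s ◁ comb z ◁ M″)
      ≈⟨ +-cong (*-congˡ (trans (det-swap r (comb z) M″) (-‿cong (first z r))))
                (*-congˡ (trans (det-swap s (comb z) M″) (-‿cong (first z s)))) ⟩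
    y₀ * - (z₀ * Det (r ◁ r ◁ M″) + z₁ * Det (s ◁ r ◁ M″)) +
    y₁ * - (z₀ * Det (r ◁ s ◁ M″) + z₁ * Det (s ◁ s ◁ M″))
      ≈⟨ +-cong (*-congˡ (-‿cong (+-cong (*-congˡ (det-repeat₀ r M″)) (*-congˡ (det-swap s r M″)))))
                (*-congˡ (-‿cong (+-congˡ (*-congˡ (det-repeat₀ s M″))))) ⟩
    y₀ * - (z₀ * 0# + z₁ * - Det (r ◁ s ◁ M″)) + y₁ * - (z₀ * Det (r ◁ s ◁ M″) + z₁ * 0#)
      -- `0#` is passed as the variable `z`; its multiples are gathered in one term, which
      -- disappears in the next step.
      ≈⟨ solve 6 (λ a b c d z e → a :* :- (c :* z :+ d :* :- e) :+ b :* :- (c :* e :+ d :* z) :=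
                                  (a :* d :- b :* c) :* e :- (a :* c :+ b :* d) :* z)
                 refl y₀ y₁ z₀ z₁ 0# (Det (r ◁ s ◁ M″)) ⟩
    (y₀ * z₁ - y₁ * z₀) * Det (r ◁ s ◁ M″) - (y₀ * z₀ + y₁ * z₁) * 0#
      ≈⟨ trans (+-congˡ (trans (-‿cong (zeroʳ _)) -0#≈0#)) (+-identityʳ _) ⟩
    (y₀ * z₁ - y₁ * z₀) * Det (r ◁ s ◁ M″)
      ≈⟨ *-congˡ (det-cong λ { zero _ → refl ; (suc zero) _ → refl ; (suc (suc i)) _ → refl }) ⟩
    (y₀ * z₁ - y₁ * z₀) * Det M ∎
    where
    comb : (Fin (suc (suc n)) → Carrier) → Fin (suc (suc n)) → Carrier
    comb w j = ∑ λ k → w k * M k j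
    M″ = tail (tail M)
    r = M zero
    s = M (suc zero)
    y₀ = y zero
    y₁ = y (suc zero)
    z₀ = z zero
    z₁ = z (suc zero)

    first : ∀ w t → Det (comb w ◁ t ◁ M″) ≈ w zero * Det (r ◁ t ◁ M″) + w (suc zero) * Det (s ◁ t ◁ M″)
    first w t = trans (det-combination w M (t ◁ M″)) (trans (∑-suc _) (+-congˡ (∑-supported₀ λ k →
      trans (*-congˡ (trans (det-swap (M″ k) t M″) (trans (-‿cong (zero-minors k)) -0#≈0#))) (zeroʳ _))))
      where
      zero-minors : ∀ k → Det (t ◁ M″ k ◁ M″) ≈ 0#
      zero-minors k = det-minors-zero λ j → trans
        (det-cong λ { zero _ → refl ; (suc i) _ → refl })
        (det-repeat (minor M″ j) k)

  -- Expanding along the first row and then the minors along their first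
  -- column gives an expression that is visibly symmetric in rows and columns.
  private
    det-expand² : (∀ (M : Mat (suc n)) → Det M ≈ Det λ i j → M j i) → ∀ (M : Mat (suc (suc n))) →
                  Det M ≈ M zero zero * Det (λ i j → M (suc i) (suc j)) -
                    ∑ λ j → ∑ λ i → (sgn j * sgn i) * ((M zero (suc j) * M (suc i) zero) *
                      Det λ b a → M (suc (punchIn i a)) (suc (punchIn j b)))
    det-expand² transpose M = begin
      Det M
        ≈⟨ trans (Det-expand M) (∑-suc _) ⟩
      sgn zero * (M zero zero * Det (λ i j → M (suc i) (suc j))) +
      ∑ (λ j → sgn (suc j) * (M zero (suc j) * Det (minor (tail M) (suc j))))
        ≈⟨ +-cong (trans (*-congʳ sgn-zero) (*-identityˡ _)) (∑-cong λ j →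
             *-cong (sgn-suc j) (*-congˡ (trans (transpose _) (Det-expand _)))) ⟩
      M zero zero * Det (λ i j → M (suc i) (suc j)) +
      ∑ (λ j → - sgn j * (M zero (suc j) * ∑ λ i → sgn i * (M (suc i) zero *
        Det λ b a → M (suc (punchIn i a)) (suc (punchIn j b)))))
        ≈⟨ +-congˡ (trans (∑-cong λ j → trans
             (solve 3 (λ s a t → :- s :* (a :* t) := :- ((s :* a) :* t)) refl (sgn j) (M zero (suc j)) _)
             (-‿cong (trans (*-distribˡ-∑ (sgn j * M zero (suc j)) _) (∑-cong λ i →
               solve 5 (λ s a c t d → (s :* a) :* (t :* (c :* d)) := (s :* t) :* ((a :* c) :* d))
                       refl (sgn j) (M zero (suc j)) (M (suc i) zero) (sgn i) _)))) (∑-neg _)) ⟩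
      M zero zero * Det (λ i j → M (suc i) (suc j)) -
      ∑ (λ j → ∑ λ i → (sgn j * sgn i) * ((M zero (suc j) * M (suc i) zero) *
        Det λ b a → M (suc (punchIn i a)) (suc (punchIn j b)))) ∎

  det-transpose : ∀ (M : Mat n) → Det M ≈ Det λ i j → M j i
  det-transpose {zero}        M = trans (Det-zero M) (sym (Det-zero _))
  det-transpose {suc zero}    M = det-cong λ { zero zero → refl }
  det-transpose {suc (suc n)} M = begin
    Det M
      ≈⟨ det-expand² det-transpose M ⟩
    M zero zero * Det (λ i j → M (suc i) (suc j)) -
      (∑ λ j → ∑ λ i → (sgn j * sgn i) * ((M zero (suc j) * M (suc i) zero) *
        Det λ b a → M (suc (punchIn i a)) (suc (punchIn j b))))
      ≈⟨ +-cong (*-congˡ (det-transpose λ i j → M (suc i) (suc j))) (-‿cong (∑-swap _)) ⟩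
    M zero zero * Det (λ i j → M (suc j) (suc i)) -
      (∑ λ i → ∑ λ j → (sgn j * sgn i) * ((M zero (suc j) * M (suc i) zero) *
        Det λ b a → M (suc (punchIn i a)) (suc (punchIn j b))))
      ≈⟨ +-congˡ (-‿cong (∑-cong λ i → ∑-cong λ j → *-cong (*-comm (sgn j) (sgn i)) (*-cong
           (*-comm (M zero (suc j)) (M (suc i) zero))
           (det-transpose λ b a → M (suc (punchIn i a)) (suc (punchIn j b)))))) ⟩
    M zero zero * Det (λ i j → M (suc j) (suc i)) -
      (∑ λ i → ∑ λ j → (sgn i * sgn j) * ((M (suc i) zero * M zero (suc j)) *
        Det λ a b → M (suc (punchIn i a)) (suc (punchIn j b))))
      ≈⟨ det-expand² det-transpose (λ i j → M j i) ⟨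
    Det (λ i j → M j i) ∎

  det-column-+ : ∀ {M N P : Mat (suc n)} → (∀ i → M i zero + N i zero ≈ P i zero) →
                 (∀ i j → M i (suc j) ≈ P i (suc j)) → (∀ i j → N i (suc j) ≈ P i (suc j)) →
                 Det M + Det N ≈ Det P
  det-column-+ {M = M} {N} {P} column M≈P N≈P = begin
    Det M + Det N                            ≈⟨ +-cong (det-transpose M) (det-transpose N) ⟩
    Det (λ i j → M j i) + Det (λ i j → N j i) ≈⟨ det-row-+ column (λ i j → M≈P j i) (λ i j → N≈P j i) ⟩
    Det (λ i j → P j i)                      ≈⟨ det-transpose P ⟨
    Det P                                    ∎

  private
    front : Fin (suc n) → Fin (suc n) → Fin (suc n)
    front u zero    = u
    front u (suc i) = punchIn u i

    -- After one swap row zero is on top again, and in the minors along it the moving row has one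
    -- place less to travel.
    det-front : ∀ u (M : Mat (suc n)) → Det (M ∘ front u) ≈ sgn u * Det M
    det-front zero M = trans (det-cong λ { zero _ → refl ; (suc i) _ → refl })
      (sym (trans (*-congʳ sgn-zero) (*-identityˡ _)))
    det-front {suc n} (suc u) M = begin
      Det (M ∘ front (suc u))
        ≈⟨ det-cong (λ { zero _ → refl ; (suc zero) _ → refl ; (suc (suc i)) _ → refl }) ⟩
      Det (M (suc u) ◁ M zero ◁ λ i → M (suc (punchIn u i)))
        ≈⟨ det-swap (M (suc u)) (M zero) (λ i → M (suc (punchIn u i))) ⟩
      - Det (M zero ◁ M (suc u) ◁ λ i → M (suc (punchIn u i)))
        ≈⟨ -‿cong (det-expand-cong {M = M zero ◁ M (suc u) ◁ λ i → M (suc (punchIn u i))} {M} (sgn u) (λ j → refl) λ j →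
             trans (det-cong λ { zero _ → refl ; (suc i) _ → refl }) (det-front u (minor (tail M) j))) ⟩
      - (sgn u * Det M)
        ≈⟨ trans (-‿distribˡ-* _ _) (*-congʳ (sym (sgn-suc u))) ⟩
      sgn (suc u) * Det M ∎

    -- Of the sign of `f` only `s * s ≈ 1#` is recorded: relabelling vertices reorders rows and
    -- columns alike, so the sign enters twice. The map `f` is split into moving row `f zero` to the
    -- front and an injection of the remaining rows.
    det-reorder-rows : ∀ (f : Fin n → Fin n) → Injective _≡_ _≡_ f →
                       ∃ λ s → s * s ≈ 1# × (∀ (M : Mat n) → Det (M ∘ f) ≈ s * Det M)
    det-reorder-rows {zero} f inj = 1# , *-identityˡ 1# , λ M → trans (det-cong λ ()) (sym (*-identityˡ _))
    det-reorder-rows {suc n} f inj with det-reorder-rows f′ f′-inj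
      where
      f0≢ : ∀ i → f zero ≡ f (suc i) → _
      f0≢ i eq = 0≢1+n (inj eq)
      f′ = λ i → punchOut (f0≢ i)
      f′-inj : Injective _≡_ _≡_ f′
      f′-inj {i} {j} eq = suc-injective (inj (punchOut-injective (f0≢ i) (f0≢ j) eq))
    ... | s , s²≈1 , reorder = s * sgn (f zero) ,
      (begin
        (s * sgn (f zero)) * (s * sgn (f zero))   ≈⟨ solve 2 (λ s t → (s :* t) :* (s :* t) := (s :* s) :* (t :* t)) refl s (sgn (f zero)) ⟩
        (s * s) * (sgn (f zero) * sgn (f zero))   ≈⟨ *-cong s²≈1 (sgn² (f zero)) ⟩
        1# * 1#                                   ≈⟨ *-identityˡ 1# ⟩
        1#                                        ∎) ,
      λ M → begin
        Det (M ∘ f)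
          ≈⟨ det-expand-cong {M = M ∘ f} {M ∘ front (f zero)} s (λ j → refl) (λ j →
               trans (det-cong λ i k → reflexive (≡.cong (λ l → M l (punchIn j k)) (≡.sym (punchIn-punchOut (λ eq → 0≢1+n (inj eq))))))
                     (reorder λ i k → M (punchIn (f zero) i) (punchIn j k))) ⟩
        s * Det (M ∘ front (f zero))     ≈⟨ *-congˡ (det-front (f zero) M) ⟩
        s * (sgn (f zero) * Det M)       ≈⟨ *-assoc _ _ _ ⟨
        (s * sgn (f zero)) * Det M       ∎

  det-relabel : ∀ (f : Fin m → Fin n) (m≡n : m ≡ n) → Injective _≡_ _≡_ f →
                ∀ M → Det (λ i j → M (f i) (f j)) ≈ Det M
  det-relabel f ≡.refl inj M with det-reorder-rows f inj
  ... | s , s²≈1 , reorder = begin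
    Det (λ i j → M (f i) (f j))   ≈⟨ reorder (λ i j → M i (f j)) ⟩
    s * Det (λ i j → M i (f j))   ≈⟨ *-congˡ (det-transpose λ i j → M i (f j)) ⟩
    s * Det (λ i j → M j (f i))   ≈⟨ *-congˡ (reorder λ i j → M j i) ⟩
    s * (s * Det (λ i j → M j i)) ≈⟨ *-assoc _ _ _ ⟨
    (s * s) * Det (λ i j → M j i) ≈⟨ *-cong s²≈1 (sym (det-transpose M)) ⟩
    1# * Det M                    ≈⟨ *-identityˡ _ ⟩
    Det M                         ∎

  δ : Fin n → Fin n → Carrier
  δ i j = if does (i ≟ j) then 1# else 0#

  δ-sym : ∀ (i j : Fin n) → δ i j ≈ δ j i
  δ-sym zero    zero    = refl
  δ-sym zero    (suc j) = refl
  δ-sym (suc i) zero    = refl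
  δ-sym (suc i) (suc j) = δ-sym i j

  ∑-δ : ∀ (i : Fin n) (f : Fin n → Carrier) → ∑ (λ k → δ i k * f k) ≈ f i
  ∑-δ zero    f = trans (∑-supported₀ λ k → zeroˡ _) (*-identityˡ _)
  ∑-δ (suc i) f = trans (∑-suc _) (trans (+-cong (zeroˡ _) (∑-δ i (f ∘ suc))) (+-identityˡ _))

  det-δ : ∀ n → Det (δ {n}) ≈ 1#
  det-δ zero    = Det-zero _
  det-δ (suc n) = trans (det-corner λ j → refl) (trans (*-identityˡ _) (det-δ n))

-- Power series and characteristic polynomials

module DetHomomorphism {c₁ ℓ₁ c₂ ℓ₂} (A : RawRing c₁ ℓ₁) (B : CommutativeRing c₂ ℓ₂)
  {φ : RawRing.Carrier A → CommutativeRing.Carrier B}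
  (φ-homo : IsRingHomomorphism A (CommutativeRing.rawRing B) φ) where

  private
    module A where
      open RawRing A public
      open Algebra.Definitions.RawSemiring rawSemiring public using (sum; _^_)
  open CommutativeRing B hiding (zero)
  open Determinant B
  open IsRingHomomorphism φ-homo
  open import Algebra.Properties.Ring ring using (-1*x≈-x)
  open import Relation.Binary.Reasoning.Setoid setoid

  sum-homo : ∀ {n} (f : Fin n → A.Carrier) → φ (A.sum f) ≈ ∑ λ i → φ (f i)
  sum-homo {zero}  f = trans 0#-homo (sym (∑-zero λ ()))
  sum-homo {suc n} f = trans (+-homo (f zero) _)
    (trans (+-congˡ (sum-homo (λ i → f (suc i)))) (sym (∑-suc _)))

  sgn-homo : ∀ {n} (j : Fin n) → φ ((A.- A.1#) A.^ toℕ j) ≈ sgn j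
  sgn-homo zero    = trans 1#-homo (sym sgn-zero)
  sgn-homo (suc j) = begin
    φ ((A.- A.1#) A.^ suc (toℕ j))             ≈⟨ *-homo _ _ ⟩
    φ (A.- A.1#) * φ ((A.- A.1#) A.^ toℕ j)    ≈⟨ *-cong (trans (-‿homo A.1#) (-‿cong 1#-homo)) (sgn-homo j) ⟩
    - 1# * sgn j                             ≈⟨ -1*x≈-x _ ⟩
    - sgn j                                  ≈⟨ sgn-suc j ⟨
    sgn (suc j)                              ∎

  -- Ring laws are required of `B` alone. Lists of coefficients can thus be mapped to power series
  -- without first being shown to form a ring.
  det-homo : ∀ {n} (M : Matrix A.Carrier n) → φ (det A M) ≈ Det λ i j → φ (M i j)
  det-homo {zero}  M = trans 1#-homo (sym (Det-zero _))
  det-homo {suc n} M = begin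
    φ (det A M)
      ≈⟨ sum-homo _ ⟩
    ∑ (λ j → φ (((A.- A.1#) A.^ toℕ j) A.* (M zero j A.* det A (λ i k → M (suc i) (punchIn j k)))))
      ≈⟨ ∑-cong (λ j → trans (*-homo _ _) (*-cong (sgn-homo j) (trans (*-homo _ _) (*-congˡ (det-homo _))))) ⟩
    ∑ (λ j → sgn j * (φ (M zero j) * Det (λ i k → φ (M (suc i) (punchIn j k)))))
      ≈⟨ Det-expand (λ i j → φ (M i j)) ⟨
    Det (λ i j → φ (M i j)) ∎

module PowerSeries {c ℓ} (R : CommutativeRing c ℓ) where
  open CommutativeRing R hiding (zero)
  open IntegerImage R using (module Solver)
  open Solver using (solve; _:=_; _:+_; _:*_)
  open import Relation.Binary.Reasoning.Setoid setoid

  Series : Set c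
  Series = ℕ → Carrier

  infix 4 _≈ˢ_
  _≈ˢ_ : Series → Series → Set ℓ
  f ≈ˢ g = ∀ k → f k ≈ g k

  conv : Series → Series → Series
  conv f g zero    = f 0 * g 0
  conv f g (suc k) = f 0 * g (suc k) + conv (f ∘ suc) g k

  conv-cong : ∀ {f f′ g g′} → f ≈ˢ f′ → g ≈ˢ g′ → conv f g ≈ˢ conv f′ g′
  conv-cong f≈ g≈ zero    = *-cong (f≈ 0) (g≈ 0)
  conv-cong f≈ g≈ (suc k) = +-cong (*-cong (f≈ 0) (g≈ (suc k))) (conv-cong (f≈ ∘ suc) g≈ k)

  conv-zeroˡ : ∀ {f} → (∀ k → f k ≈ 0#) → ∀ g k → conv f g k ≈ 0#
  conv-zeroˡ f≈0 g zero    = trans (*-congʳ (f≈0 0)) (zeroˡ _)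
  conv-zeroˡ f≈0 g (suc k) = trans
    (+-cong (trans (*-congʳ (f≈0 0)) (zeroˡ _)) (conv-zeroˡ (f≈0 ∘ suc) g k)) (+-identityˡ _)

  conv-+ʳ : ∀ f g h k → conv (λ i → g i + h i) f k ≈ conv g f k + conv h f k
  conv-+ʳ f g h zero    = distribʳ _ _ _
  conv-+ʳ f g h (suc k) = trans (+-congˡ (conv-+ʳ f (g ∘ suc) (h ∘ suc) k))
    (solve 5 (λ g h f u v → (g :+ h) :* f :+ (u :+ v) := (g :* f :+ u) :+ (h :* f :+ v))
             refl (g 0) (h 0) (f (suc k)) _ _)

  conv-scaleˡ : ∀ a f g k → conv (λ i → a * f i) g k ≈ a * conv f g k
  conv-scaleˡ a f g zero    = *-assoc _ _ _
  conv-scaleˡ a f g (suc k) = trans (+-cong (*-assoc _ _ _) (conv-scaleˡ a (f ∘ suc) g k)) (sym (distribˡ _ _ _))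

  conv-sucʳ : ∀ f g k → conv f g (suc k) ≈ f (suc k) * g 0 + conv f (g ∘ suc) k
  conv-sucʳ f g zero    = +-comm _ _
  conv-sucʳ f g (suc k) = trans (+-congˡ (conv-sucʳ (f ∘ suc) g k))
    (solve 3 (λ a b c → a :+ (b :+ c) := b :+ (a :+ c)) refl _ _ _)

  conv-comm : ∀ f g k → conv f g k ≈ conv g f k
  conv-comm f g zero    = *-comm _ _
  conv-comm f g (suc k) = trans (+-cong (*-comm _ _) (conv-comm (f ∘ suc) g k)) (sym (conv-sucʳ g f k))

  conv-assoc : ∀ f g h k → conv (conv f g) h k ≈ conv f (conv g h) k
  conv-assoc f g h zero    = *-assoc _ _ _
  conv-assoc f g h (suc k) = begin
    (f 0 * g 0) * h (suc k) + conv (λ i → f 0 * g (suc i) + conv (f ∘ suc) g i) h k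
      ≈⟨ +-cong (*-assoc _ _ _) (trans (conv-+ʳ h (λ i → f 0 * g (suc i)) (conv (f ∘ suc) g) k)
                 (+-cong (conv-scaleˡ (f 0) (g ∘ suc) h k) (conv-assoc (f ∘ suc) g h k))) ⟩
    f 0 * (g 0 * h (suc k)) + (f 0 * conv (g ∘ suc) h k + conv (f ∘ suc) (conv g h) k)
      ≈⟨ trans (sym (+-assoc _ _ _)) (+-congʳ (sym (distribˡ _ _ _))) ⟩
    f 0 * (g 0 * h (suc k) + conv (g ∘ suc) h k) + conv (f ∘ suc) (conv g h) k ∎

  const : Carrier → Series
  const a zero    = a
  const a (suc _) = 0#

  conv-const : ∀ a g k → conv (const a) g k ≈ a * g k
  conv-const a g zero    = refl
  conv-const a g (suc k) = trans (+-congˡ (conv-zeroˡ (λ _ → refl) g k)) (+-identityʳ _)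

  seriesRing : CommutativeRing c ℓ
  seriesRing = record
    { Carrier = Series
    ; _≈_ = _≈ˢ_
    ; _+_ = λ f g k → f k + g k
    ; _*_ = conv
    ; -_  = λ f k → - f k
    ; 0#  = λ _ → 0#
    ; 1#  = const 1#
    ; isCommutativeRing = record
      { isRing = record
        { +-isAbelianGroup = record
          { isGroup = record
            { isMonoid = record
              { isSemigroup = record
                { isMagma = record
                  { isEquivalence = record
                    { refl  = λ _ → refl
                    ; sym   = λ p k → sym (p k)
                    ; trans = λ p q k → trans (p k) (q k)
                    }
                  ; ∙-cong = λ p q k → +-cong (p k) (q k)
                  }
                ; assoc = λ f g h k → +-assoc _ _ _
                }
              ; identity = (λ f k → +-identityˡ _) , (λ f k → +-identityʳ _)
              }
            ; inverse = (λ f k → -‿inverseˡ _) , (λ f k → -‿inverseʳ _)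
            ; ⁻¹-cong = λ p k → -‿cong (p k)
            }
          ; comm = λ f g k → +-comm _ _
          }
        ; *-cong = conv-cong
        ; *-assoc = conv-assoc
        ; *-identity = one* , λ f k → trans (conv-comm f (const 1#) k) (one* f k)
        ; distrib = (λ f g h k → trans (conv-comm f _ k) (trans (conv-+ʳ f g h k)
                      (+-cong (conv-comm g f k) (conv-comm h f k))))
                  , conv-+ʳ
        }
      ; *-comm = conv-comm
      }
    }
    where
    one* : ∀ f → conv (const 1#) f ≈ˢ f
    one* f k = trans (conv-const 1# f k) (*-identityˡ _)

  module S where
    open CommutativeRing seriesRing hiding (zero) public
    open Determinant seriesRing public

  open Determinant R using (∑; ∑-zero; ∑-suc; ∑-cong; δ; det-δ)

  head-homo : IsRingHomomorphism S.rawRing rawRing (λ f → f 0)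
  head-homo = record
    { isSemiringHomomorphism = record
      { isNearSemiringHomomorphism = record
        { +-isMonoidHomomorphism = record
          { isMagmaHomomorphism = record
            { isRelHomomorphism = record { cong = λ p → p 0 }
            ; homo = λ _ _ → refl
            }
          ; ε-homo = refl
          }
        ; *-homo = λ _ _ → refl
        }
      ; 1#-homo = refl
      }
    ; -‿homo = λ _ → refl
    }

  ∑-coeff : ∀ {n} (f : Fin n → Series) k → S.∑ f k ≈ ∑ λ i → f i k
  ∑-coeff {zero}  f k = trans (S.∑-zero (λ ()) k) (sym (∑-zero λ ()))
  ∑-coeff {suc n} f k = trans (S.∑-suc f k) (trans (+-congˡ (∑-coeff (f ∘ suc) k)) (sym (∑-suc _)))

  module _ where
    open Polynomial rawRing using (coeff; _+ᴾ_; _*ᴾ_; polyRawRing)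

    coeff-+ : ∀ p q k → coeff (p +ᴾ q) k ≈ coeff p k + coeff q k
    coeff-+ []      q       k       = sym (+-identityˡ _)
    coeff-+ (a ∷ p) []      k       = sym (+-identityʳ _)
    coeff-+ (a ∷ p) (b ∷ q) zero    = refl
    coeff-+ (a ∷ p) (b ∷ q) (suc k) = coeff-+ p q k

    coeff-scale : ∀ a p k → coeff (List.map (a *_) p) k ≈ a * coeff p k
    coeff-scale a []      k       = sym (zeroʳ _)
    coeff-scale a (b ∷ p) zero    = refl
    coeff-scale a (b ∷ p) (suc k) = coeff-scale a p k

    coeff-neg : ∀ p k → coeff (List.map (-_) p) k ≈ - coeff p k
    coeff-neg []      k       = sym -0#≈0#
      where open import Algebra.Properties.Ring ring using (-0#≈0#)
    coeff-neg (b ∷ p) zero    = refl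
    coeff-neg (b ∷ p) (suc k) = coeff-neg p k

    coeff-* : ∀ p q k → coeff (p *ᴾ q) k ≈ conv (coeff p) (coeff q) k
    coeff-* []      q k       = sym (conv-zeroˡ (λ _ → refl) (coeff q) k)
    coeff-* (a ∷ p) q zero    = trans (coeff-+ (List.map (a *_) q) _ 0)
      (trans (+-identityʳ _) (coeff-scale a q 0))
    coeff-* (a ∷ p) q (suc k) = trans (coeff-+ (List.map (a *_) q) _ (suc k))
      (+-cong (coeff-scale a q (suc k)) (coeff-* p q k))

    coeff-homo : IsRingHomomorphism polyRawRing S.rawRing coeff
    coeff-homo = record
      { isSemiringHomomorphism = record
        { isNearSemiringHomomorphism = record
          { +-isMonoidHomomorphism = record
            { isMagmaHomomorphism = record
              { isRelHomomorphism = record { cong = λ p → p }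
              ; homo = coeff-+
              }
            ; ε-homo = λ _ → refl
            }
          ; *-homo = coeff-*
          }
        ; 1#-homo = λ { zero → refl ; (suc _) → refl }
        }
      ; -‿homo = coeff-neg
      }

  linear : Carrier → Carrier → Series
  linear a b zero          = a
  linear a b (suc zero)    = b
  linear a b (suc (suc _)) = 0#

  linear-cong : ∀ {a a′ b b′} → a ≈ a′ → b ≈ b′ → linear a b ≈ˢ linear a′ b′
  linear-cong a≈ b≈ zero          = a≈
  linear-cong a≈ b≈ (suc zero)    = b≈
  linear-cong a≈ b≈ (suc (suc _)) = refl

  linear-* : ∀ a b f k → conv (linear a b) f (suc k) ≈ a * f (suc k) + b * f k
  linear-* a b f zero    = refl
  linear-* a b f (suc k) = +-congˡ (trans (+-congˡ (conv-zeroˡ (λ _ → refl) f k)) (+-identityʳ _))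

  -- p = xⁿ s(1/x)
  Reversed : ℕ → Series → Series → Set ℓ
  Reversed n p s = (∀ i k → i ℕ.+ k ≡ n → p i ≈ s k)
                 × (∀ i → n < i → p i ≈ 0#)
                 × (∀ k → n < k → s k ≈ 0#)

  reversed-cong : ∀ {n p p′ s s′} → p ≈ˢ p′ → s ≈ˢ s′ → Reversed n p′ s′ → Reversed n p s
  reversed-cong p≈ s≈ (r , z , w) = (λ i k eq → trans (p≈ i) (trans (r i k eq) (sym (s≈ k))))
    , (λ i lt → trans (p≈ i) (z i lt)) , (λ k lt → trans (s≈ k) (w k lt))

  -- Vanishing beyond degree `n` settles the two ends: for `i = 0` and for `k = 0` one of the two
  -- products has no partner on the other side, and it is zero.
  reversed-linear : ∀ {n p s} a b → Reversed n p s →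
                    Reversed (suc n) (conv (linear a b) p) (conv (linear b a) s)
  reversed-linear {n} {p} {s} a b (r , z , w) = r′ , z′ p z , z′ s w
    where
    z′ : ∀ {a b} p → (∀ i → n < i → p i ≈ 0#) → ∀ i → suc n < i → conv (linear a b) p i ≈ 0#
    z′ p z (suc i) (s≤s lt) = trans (linear-* _ _ p i)
      (trans (+-cong (trans (*-congˡ (z (suc i) (ℕₚ.m≤n⇒m≤1+n lt))) (zeroʳ _)) (trans (*-congˡ (z i lt)) (zeroʳ _)))
             (+-identityʳ _))
    r′ : ∀ i k → i ℕ.+ k ≡ suc n → conv (linear a b) p i ≈ conv (linear b a) s k
    r′ zero .(suc n) ≡.refl = sym (trans (linear-* b a s n)
      (trans (+-cong (trans (*-congˡ (w (suc n) ℕₚ.≤-refl)) (zeroʳ _)) (*-congˡ (sym (r 0 n ≡.refl)))) (+-identityˡ _)))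
    r′ (suc i) zero eq = trans (linear-* a b p i) (trans
      (+-cong (trans (*-congˡ (z (suc i) (ℕₚ.≤-reflexive (≡.cong suc (≡.trans (≡.sym i≡n) (ℕₚ.+-identityʳ i))))))
                     (zeroʳ _))
              (*-congˡ (r i 0 i≡n))) (+-identityˡ _))
      where i≡n = ℕₚ.suc-injective eq
    r′ (suc i) (suc k) eq = trans (linear-* a b p i) (trans
      (trans (+-cong (*-congˡ (r (suc i) k (≡.trans (≡.sym (ℕₚ.+-suc i k)) i+1+k≡n))) (*-congˡ (r i (suc k) i+1+k≡n)))
             (+-comm _ _))
      (sym (linear-* b a s k)))
      where i+1+k≡n = ℕₚ.suc-injective eq

  reversed-sgn : ∀ {n p s m} (j : Fin m) → Reversed n p s → Reversed n (S.sgn j S.* p) (S.sgn j S.* s)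
  reversed-sgn zero rev = reversed-cong
    (S.trans (S.*-congʳ S.sgn-zero) (S.*-identityˡ _)) (S.trans (S.*-congʳ S.sgn-zero) (S.*-identityˡ _)) rev
  reversed-sgn {p = p} {s} (suc j) rev = reversed-cong (neg p) (neg s) (reversed-neg (reversed-sgn j rev))
    where
    open import Algebra.Properties.Ring ring using (-0#≈0#)
    open import Algebra.Properties.Ring S.ring using (-‿distribˡ-*)
    neg : ∀ p → S.sgn (suc j) S.* p S.≈ S.- (S.sgn j S.* p)
    neg p = S.trans (S.*-congʳ (S.sgn-suc j)) (S.sym (-‿distribˡ-* (S.sgn j) p))
    reversed-neg : ∀ {n p s} → Reversed n p s → Reversed n (S.- p) (S.- s)
    reversed-neg (r , z , w) = (λ i k eq → -‿cong (r i k eq))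
      , (λ i lt → trans (-‿cong (z i lt)) -0#≈0#) , (λ k lt → trans (-‿cong (w k lt)) -0#≈0#)

  reversed-∑ : ∀ {n m} {p s : Fin m → Series} → (∀ j → Reversed n (p j) (s j)) → Reversed n (S.∑ p) (S.∑ s)
  reversed-∑ {p = p} {s} rev = reversed-cong (∑-coeff p) (∑-coeff s)
    ( (λ i k eq → ∑-cong λ j → proj₁ (rev j) i k eq)
    , (λ i lt → ∑-zero λ j → proj₁ (proj₂ (rev j)) i lt)
    , (λ k lt → ∑-zero λ j → proj₂ (proj₂ (rev j)) k lt))

  -- Two arbitrary coefficient matrices are allowed because the minors in the expansion of `x I − M`
  -- are in general not characteristic matrices again.
  reversed-det : ∀ {n} (P Q : Matrix Carrier n) →
                 Reversed n (S.Det λ i j → linear (P i j) (Q i j)) (S.Det λ i j → linear (Q i j) (P i j))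
  reversed-det {zero} P Q = reversed-cong (S.Det-zero _) (S.Det-zero _)
    ( (λ { zero k ≡.refl → refl ; (suc i) k () })
    , (λ { (suc i) lt → refl })
    , (λ { (suc i) lt → refl }))
  reversed-det {suc n} P Q = reversed-cong (S.Det-expand _) (S.Det-expand _)
    (reversed-∑ λ j → reversed-sgn j (reversed-linear _ _ (reversed-det _ _)))

  reversed-unique : ∀ {n p p′ s s′} → Reversed n p s → Reversed n p′ s′ →
                    (p ≈ˢ p′ → s ≈ˢ s′) × (s ≈ˢ s′ → p ≈ˢ p′)
  reversed-unique {n} {p} {p′} {s} {s′} (r , z , w) (r′ , z′ , w′) = to , from
    where
    to : p ≈ˢ p′ → s ≈ˢ s′
    to eq k with ℕₚ.≤-<-connex k n
    ... | inj₁ k≤n = trans (sym (r _ k (ℕₚ.m∸n+n≡m k≤n))) (trans (eq _) (r′ _ k (ℕₚ.m∸n+n≡m k≤n)))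
    ... | inj₂ n<k = trans (w k n<k) (sym (w′ k n<k))
    from : s ≈ˢ s′ → p ≈ˢ p′
    from eq i with ℕₚ.≤-<-connex i n
    ... | inj₁ i≤n = trans (r i _ (ℕₚ.m+[n∸m]≡n i≤n)) (trans (eq _) (sym (r′ i _ (ℕₚ.m+[n∸m]≡n i≤n))))
    ... | inj₂ n<i = trans (z i n<i) (sym (z′ i n<i))

  -- I − tM
  resolvent : ∀ {n} → Matrix Carrier n → Matrix Series n
  resolvent M i j = linear (δ i j) (- M i j)

  detSeries : ∀ {n} → Matrix Carrier n → Series
  detSeries M = S.Det (resolvent M)

  -- Setting t = 0 is a ring homomorphism and turns I - tM into I. The value 1 is used both to
  -- cancel this determinant and to see that the characteristic polynomial is monic.
  detSeries-0 : ∀ {n} (M : Matrix Carrier n) → detSeries M 0 ≈ 1#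
  detSeries-0 {n} M = trans (reflexive (≡.cong (λ f → f 0) (≡.sym (S.det≡Det (resolvent M)))))
    (trans (DetHomomorphism.det-homo S.rawRing R head-homo (resolvent M)) (det-δ n))

module ℤ⟦t⟧ = PowerSeries ℤₚ.+-*-commutativeRing

module _ where
  open ℤ⟦t⟧
  open Determinant ℤₚ.+-*-commutativeRing using (δ)
  open Polynomial +-*-rawRing using (coeff; polyRawRing)

  charPoly-coeff : ∀ {n} (M : Matrix ℤ n) → coeff (charPoly M) ≈ˢ S.Det λ i j → linear (ℤ.- M i j) (δ i j)
  charPoly-coeff M = S.trans (DetHomomorphism.det-homo polyRawRing seriesRing coeff-homo _)
    (S.det-cong λ i j → entry i j (does (i ≟ j)))
    where
    entry : ∀ i j b → coeff (if b then Polynomial.X-_ +-*-rawRing (M i j) else [ ℤ.- M i j ]) ≈ˢ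
                      linear (ℤ.- M i j) (if b then 1ℤ else ℤ.0ℤ)
    entry i j true  zero          = ≡.refl
    entry i j true  (suc zero)    = ≡.refl
    entry i j true  (suc (suc k)) = ≡.refl
    entry i j false zero          = ≡.refl
    entry i j false (suc zero)    = ≡.refl
    entry i j false (suc (suc k)) = ≡.refl

  charPoly-reversed : ∀ {n} (M : Matrix ℤ n) → Reversed n (coeff (charPoly M)) (detSeries M)
  charPoly-reversed M = reversed-cong (charPoly-coeff M) S.refl (reversed-det _ _)

-- Spectra

module Spectra {c ℓ₁ ℓ₂} (K : AlgClosedFieldChar0 c ℓ₁ ℓ₂) where
  open AlgClosedFieldChar0 K using (heytingField; charZero; algClosed; fromℤ; Poly; _*ᴾ_; X-_; eval; _#_)
  open HeytingField heytingField using (heytingCommutativeRing; #-irrefl; #-cotrans)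
  open HeytingCommutativeRing heytingCommutativeRing using (commutativeRing)
  open CommutativeRing commutativeRing hiding (zero)
  open Polynomial rawRing using (coeff)
  open Polynomial +-*-rawRing using () renaming (coeff to coeffℤ)
  open IntegerImage commutativeRing
  open Solver using (solve; _:=_; _:+_; _:*_; :-_; con)
  open PowerSeries commutativeRing using (_≈ˢ_; conv; conv-cong; coeff-*; linear; linear-*)
  open import Algebra.Properties.Ring ring using (-0#≈0#; -‿involutive; x≈y⇒x∙y⁻¹≈ε)
  open import Relation.Binary.Reasoning.Setoid setoid

  fromℤ≈⟦⟧ : ∀ i → fromℤ i ≈ ⟦ i ⟧ℤ
  fromℤ≈⟦⟧ (+ n)    = refl
  fromℤ≈⟦⟧ -[1+ n ] = refl

  ⟦⟧-zero : ∀ i → ⟦ i ⟧ℤ ≈ 0# → i ≡ ℤ.0ℤ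
  ⟦⟧-zero (+ zero)  i≈0 = ≡.refl
  ⟦⟧-zero (+ suc n) i≈0 = contradiction (charZero n) (#-irrefl i≈0)
  ⟦⟧-zero -[1+ n ]  i≈0 = contradiction (charZero n)
    (#-irrefl (trans (sym (-‿involutive _)) (trans (-‿cong i≈0) -0#≈0#)))

  fromℤ-injective : ∀ i j → fromℤ i ≈ fromℤ j → i ≡ j
  fromℤ-injective i j eq = ℤₚ.i-j≡0⇒i≡j i j (⟦⟧-zero (i ℤ.- j) (begin
    ⟦ i ℤ.- j ⟧ℤ          ≈⟨ trans (⟦+⟧ i (ℤ.- j)) (+-congˡ (⟦-⟧ j)) ⟩
    ⟦ i ⟧ℤ - ⟦ j ⟧ℤ       ≈⟨ x≈y⇒x∙y⁻¹≈ε (trans (sym (fromℤ≈⟦⟧ i)) (trans eq (fromℤ≈⟦⟧ j))) ⟩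
    0#                    ∎))

  -- `charZero 0` speaks of `1# + 0#`; cotransitivity carries the apartness over to `1#`.
  1#0 : 1# # 0#
  1#0 with #-cotrans (charZero 0) 1#
  ... | inj₁ 1+0#1 = contradiction 1+0#1 (#-irrefl (+-identityʳ 1#))
  ... | inj₂ 1#0   = 1#0

  -- Synthetic division of `b ∷ p ++ [ 1# ]` by X - x: the coefficients are the Horner values of the
  -- successive tails of the dividend. The leading `1#` of dividend and quotient is left out of the
  -- lists and appended where needed.
  quotient : Carrier → Poly → Poly
  quotient x []      = []
  quotient x (a ∷ p) = eval (a ∷ p ++ [ 1# ]) x ∷ quotient x p

  quotient-length : ∀ x p → length (quotient x p) ≡ length p
  quotient-length x []      = ≡.refl
  quotient-length x (a ∷ p) = ≡.cong suc (quotient-length x p)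

  quotient-head : ∀ x p → coeff (quotient x p ++ [ 1# ]) 0 ≈ eval (p ++ [ 1# ]) x
  quotient-head x []      = sym (trans (+-congˡ (zeroʳ x)) (+-identityʳ 1#))
  quotient-head x (a ∷ p) = refl

  quotient-coeff : ∀ x p k → coeff (p ++ [ 1# ]) k ≈
                   - x * coeff (quotient x p ++ [ 1# ]) (suc k) + 1# * coeff (quotient x p ++ [ 1# ]) k
  quotient-coeff x []      zero    = sym (trans (+-cong (zeroʳ (- x)) (*-identityˡ 1#)) (+-identityˡ 1#))
  quotient-coeff x []      (suc k) = sym (trans (+-cong (zeroʳ (- x)) (zeroʳ 1#)) (+-identityˡ 0#))
  quotient-coeff x (a ∷ p) zero    = sym (trans (+-congʳ (*-congˡ (quotient-head x p)))
    (solve 3 (λ x e a → :- x :* e :+ con (+ 1) :* (a :+ x :* e) := a) refl x (eval (p ++ [ 1# ]) x) a))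
  quotient-coeff x (a ∷ p) (suc k) = quotient-coeff x p k

  X-coeff : ∀ x → coeff (X- x) ≈ˢ linear (- x) 1#
  X-coeff x zero          = refl
  X-coeff x (suc zero)    = refl
  X-coeff x (suc (suc k)) = refl

  quotient-exact : ∀ x b p → eval (b ∷ p ++ [ 1# ]) x ≈ 0# →
                   coeff (b ∷ p ++ [ 1# ]) ≈ˢ conv (linear (- x) 1#) (coeff (quotient x p ++ [ 1# ]))
  quotient-exact x b p root zero = begin
    b                                                ≈⟨ solve 3 (λ b x e → b := (b :+ x :* e) :+ :- x :* e) refl b x e ⟩
    (b + x * e) + - x * e                            ≈⟨ +-cong root (*-congˡ (sym (quotient-head x p))) ⟩
    0# + - x * coeff (quotient x p ++ [ 1# ]) 0      ≈⟨ +-identityˡ _ ⟩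
    - x * coeff (quotient x p ++ [ 1# ]) 0           ∎
    where e = eval (p ++ [ 1# ]) x
  quotient-exact x b p root (suc k) = trans (quotient-coeff x p k) (sym (linear-* (- x) 1# _ k))

  fromRoots : List Carrier → Poly
  fromRoots = foldr (λ θ p → (X- θ) *ᴾ p) [ 1# ]

  -- The recursion is on the length, as the quotient is not a sublist of the dividend. Since
  -- quotients stay monic, `algClosed` is only ever asked about the leading coefficient `1#`.
  monic-splits : ∀ n p → length p ≡ n → ∃ λ θs → coeff (p ++ [ 1# ]) ≈ˢ coeff (fromRoots θs)
  monic-splits n       []      len = [] , λ _ → refl
  monic-splits (suc n) (b ∷ p) len =
    let x , root = algClosed b p 1# 1#0
        θs , splits = monic-splits n (quotient x p) (≡.trans (quotient-length x p) (ℕₚ.suc-injective len))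
    in x ∷ θs , λ k → trans (quotient-exact x b p root k)
         (trans (conv-cong (λ i → sym (X-coeff x i)) splits k) (sym (coeff-* (X- x) (fromRoots θs) k)))

  -- The list of a characteristic polynomial may end in zeros; this brings it into the form that
  -- `monic-splits` accepts, with exactly `n` coefficients before the leading one.
  monic-coeff : ∀ n (s : ℕ → Carrier) → s n ≈ 1# → (∀ k → n < k → s k ≈ 0#) →
                s ≈ˢ coeff (applyUpTo s n ++ [ 1# ])
  monic-coeff zero    s one zeros zero    = one
  monic-coeff zero    s one zeros (suc k) = zeros (suc k) (s≤s z≤n)
  monic-coeff (suc n) s one zeros zero    = refl
  monic-coeff (suc n) s one zeros (suc k) =
    monic-coeff n (λ i → s (suc i)) one (λ k n<k → zeros (suc k) (s≤s n<k)) k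

  coeff-fromℤ : ∀ p k → coeff (map fromℤ p) k ≈ fromℤ (coeffℤ p k)
  coeff-fromℤ []      k       = refl
  coeff-fromℤ (a ∷ p) zero    = refl
  coeff-fromℤ (a ∷ p) (suc k) = coeff-fromℤ p k

  charPoly-splits : ∀ {n} (M : Matrix ℤ n) → ∃ (IsSpectrum K M)
  charPoly-splits {n} M =
    let p , _ , zeros = charPoly-reversed M
        s = coeff (map fromℤ (charPoly M))
        -- By reversal the leading coefficient is the constant term of det (I - tM).
        monic : s n ≈ 1#
        monic = trans (coeff-fromℤ (charPoly M) n) (trans
          (reflexive (≡.cong fromℤ (≡.trans (p n 0 (ℕₚ.+-identityʳ n)) (ℤ⟦t⟧.detSeries-0 M))))
          (+-identityʳ 1#))
        θs , splits = monic-splits _ (applyUpTo s n) ≡.refl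
    in θs , λ k → trans (monic-coeff n s monic
         (λ k n<k → trans (coeff-fromℤ (charPoly M) k)
           (reflexive (≡.cong fromℤ (proj₁ (proj₂ (charPoly-reversed M)) k n<k)))) k) (splits k)

  sameSpectrum⇒detSeries : ∀ {m n} (M : Matrix ℤ m) (N : Matrix ℤ n) → m ≡ n →
                           SameSpectrum K M N → ∀ k → ℤ⟦t⟧.detSeries M k ≡ ℤ⟦t⟧.detSeries N k
  sameSpectrum⇒detSeries M N ≡.refl (θs , spM , spN) =
    proj₁ (ℤ⟦t⟧.reversed-unique (charPoly-reversed M) (charPoly-reversed N)) λ k →
      fromℤ-injective _ _ (trans (sym (coeff-fromℤ (charPoly M) k))
        (trans (spM k) (trans (sym (spN k)) (coeff-fromℤ (charPoly N) k))))

  -- The sizes have to be compared separately, since det (I - tM) does not show the multiplicity of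
  -- the eigenvalue 0. An enumeration found for `M` then serves `N` as well.
  detSeries⇒sameSpectrum : ∀ {m n} (M : Matrix ℤ m) (N : Matrix ℤ n) → m ≡ n →
                           (∀ k → ℤ⟦t⟧.detSeries M k ≡ ℤ⟦t⟧.detSeries N k) → SameSpectrum K M N
  detSeries⇒sameSpectrum M N ≡.refl eq =
    let θs , spM = charPoly-splits M in θs , spM , λ k →
      trans (coeff-fromℤ (charPoly N) k) (trans (reflexive (≡.cong fromℤ (≡.sym
        (proj₂ (ℤ⟦t⟧.reversed-unique (charPoly-reversed M) (charPoly-reversed N)) eq k))))
        (trans (sym (coeff-fromℤ (charPoly M) k)) (spM k)))

-- Determinants of perturbed matrices

frame : ∀ {a} {A : Set a} {n} → A → (Fin n → A) → (Fin n → A) → Matrix A n → Matrix A (suc n)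
frame d r c M zero    zero    = d
frame d r c M zero    (suc j) = r j
frame d r c M (suc i) zero    = c i
frame d r c M (suc i) (suc j) = M i j

module InverseMatrix {c ℓ} (R : CommutativeRing c ℓ) where
  open CommutativeRing R hiding (zero)
  open IntegerImage R using (module Solver)
  open Solver using (solve; _:=_; _:+_; _:*_; _:-_; :-_; con)
  open Determinant R
  open import Algebra.Properties.Ring ring using (-‿distribˡ-*; -0#≈0#)
  open import Relation.Binary.Reasoning.Setoid setoid

  det-frame-corner : ∀ {n} d d′ r c (M : Matrix Carrier n) →
                     Det (frame d′ r c M) ≈ Det (frame d r c M) + (d′ - d) * Det M
  det-frame-corner d d′ r c M = sym (trans (+-congˡ (sym (det-corner λ j → refl))) (det-row-+
    {M = frame d r c M} {N = frame (d′ - d) (λ _ → 0#) c M} {P = frame d′ r c M}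
    (λ { zero → solve 2 (λ d d′ → d :+ (d′ :- d) := d′) refl d d′ ; (suc j) → +-identityʳ _ })
    (λ { i zero → refl ; i (suc j) → refl })
    (λ { i zero → refl ; i (suc j) → refl })))

  comb : ∀ {m n} → (Fin m → Fin n → Carrier) → (Fin m → Carrier) → Fin n → Carrier
  comb B y j = ∑ λ k → y k * B k j

  comb-+ : ∀ {m n} (B : Fin m → Fin n → Carrier) y z j → comb B (λ k → y k + z k) j ≈ comb B y j + comb B z j
  comb-+ B y z j = trans (∑-cong λ k → distribʳ _ _ _) (∑-+ _ _)

  comb-scale : ∀ {m n} (B : Fin m → Fin n → Carrier) a y j → comb B (λ k → a * y k) j ≈ a * comb B y j
  comb-scale B a y j = trans (∑-cong λ k → *-assoc _ _ _) (sym (*-distribˡ-∑ a _))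

  comb-neg : ∀ {m n} (B : Fin m → Fin n → Carrier) y j → comb B (λ k → - y k) j ≈ - comb B y j
  comb-neg B y j = trans (∑-cong λ k → sym (-‿distribˡ-* _ _)) (∑-neg _)

  -- A Schur complement without division: subtracting the combination `y` of the lower rows clears
  -- the first row except for its corner.
  det-frame : ∀ {n} d r c (M : Matrix Carrier n) y → (∀ j → comb M y j ≈ r j) →
              Det (frame d r c M) ≈ (d - ∑ λ k → y k * c k) * Det M
  det-frame d r c M y yM≈r = begin
    Det (frame d r c M)
      ≈⟨ trans (sym (*-identityˡ _)) (sym (det-row₀ (1# ◁ λ k → - y k) (frame d r c M))) ⟩
    Det (comb (frame d r c M) (1# ◁ λ k → - y k) ◁ tail (frame d r c M))
      ≈⟨ det-corner (λ j → trans (∑-suc _) (trans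
           (+-cong (*-identityˡ _) (trans (comb-neg M y j) (-‿cong (yM≈r j)))) (-‿inverseʳ _))) ⟩
    comb (frame d r c M) (1# ◁ λ k → - y k) zero * Det M
      ≈⟨ *-congʳ (trans (∑-suc _) (+-cong (*-identityˡ d) (trans (∑-cong λ k → sym (-‿distribˡ-* _ _)) (∑-neg _)))) ⟩
    (d - ∑ λ k → y k * c k) * Det M ∎

  -- CB = I writes each unit row as a combination of the rows of B. The formulas for replaced rows
  -- then read determinants off the entries of C, in place of adjugates.
  LeftInverse : ∀ {n} → Matrix Carrier n → Matrix Carrier n → Set ℓ
  LeftInverse C B = ∀ i j → comb B (C i) j ≈ δ i j

  module _ {n} {B C : Matrix Carrier (suc n)} (CB≈1 : LeftInverse C B) where

    -- Cramer's rule: the minor is the determinant of `B` with its first row replaced by a unit row,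
    -- which is the combination `C zero` of the rows of `B`.
    det-minor₀ : Det (λ i j → B (suc i) (suc j)) ≈ C zero zero * Det B
    det-minor₀ = begin
      Det (λ i j → B (suc i) (suc j))
        ≈⟨ trans (sym (*-identityˡ _)) (sym (det-corner λ j → refl)) ⟩
      Det (δ zero ◁ tail B)
        ≈⟨ det-cong (λ { zero j → sym (CB≈1 zero j) ; (suc i) j → refl }) ⟩
      Det (comb B (C zero) ◁ tail B)
        ≈⟨ det-row₀ (C zero) B ⟩
      C zero zero * Det B ∎

    det-loop : ∀ {M} τ → (∀ j → M zero j ≈ B zero j + τ * δ zero j) → (∀ i j → M (suc i) j ≈ B (suc i) j) →
               Det M ≈ (1# + τ * C zero zero) * Det B
    det-loop {M} τ row rest = begin
      Det M
        ≈⟨ det-cong (λ { zero j → trans (row j) (sym (comb-δ+ j)) ; (suc i) j → rest i j }) ⟩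
      Det (comb B y ◁ tail B)
        ≈⟨ det-row₀ y B ⟩
      (1# + τ * C zero zero) * Det B ∎
      where
      y : Fin (suc n) → Carrier
      y k = δ zero k + τ * C zero k
      comb-δ+ : ∀ j → comb B y j ≈ B zero j + τ * δ zero j
      comb-δ+ j = trans (comb-+ B _ _ j) (+-cong (∑-δ zero λ k → B k j) (trans (comb-scale B τ _ j) (*-congˡ (CB≈1 zero j))))

  module _ {n} {B C : Matrix Carrier (suc (suc n))} (CB≈1 : LeftInverse C B) where

    det-rows₀₁ : ∀ {M : Matrix Carrier (suc (suc n))} y z → (∀ j → M 0F j ≈ comb B y j) → (∀ j → M 1F j ≈ comb B z j) →
                 (∀ i j → M (suc (suc i)) j ≈ B (suc (suc i)) j) →
                 Det M ≈ (y 0F * z 1F - y 1F * z 0F) * Det B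
    det-rows₀₁ y z row₀ row₁ rest = trans
      (det-cong λ { zero j → row₀ j ; (suc zero) j → row₁ j ; (suc (suc i)) j → rest i j })
      (det-row₀₁ y z B)

    det-minor₀₁ : Det (λ i j → B (suc (suc i)) (suc (suc j))) ≈ (C 0F 0F * C 1F 1F - C 0F 1F * C 1F 0F) * Det B
    det-minor₀₁ = begin
      Det (λ i j → B (suc (suc i)) (suc (suc j)))
        ≈⟨ trans (sym (*-identityˡ _)) (sym (det-corner λ j → refl)) ⟩
      Det ((λ j → δ 1F (suc j)) ◁ λ i j → B (suc (suc i)) (suc j))
        ≈⟨ trans (sym (*-identityˡ _)) (sym (trans (det-corner λ j → refl)
             (*-congˡ (det-cong λ { zero j → refl ; (suc i) j → refl })))) ⟩
      Det (δ 0F ◁ δ 1F ◁ tail (tail B))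
        ≈⟨ det-rows₀₁ (C 0F) (C 1F) (λ j → sym (CB≈1 0F j)) (λ j → sym (CB≈1 1F j)) (λ i j → refl) ⟩
      (C 0F 0F * C 1F 1F - C 0F 1F * C 1F 0F) * Det B ∎

    det-cross : ∀ {M} τ → (∀ j → M 0F j ≈ B 0F j + τ * δ 1F j) → (∀ j → M 1F j ≈ B 1F j + τ * δ 0F j) →
                (∀ i j → M (suc (suc i)) j ≈ B (suc (suc i)) j) →
                Det M ≈ ((1# + τ * C 1F 0F) * (1# + τ * C 0F 1F) - (τ * C 1F 1F) * (τ * C 0F 0F)) * Det B
    det-cross τ row₀ row₁ rest = trans
      (det-rows₀₁ (λ k → δ 0F k + τ * C 1F k) (λ k → δ 1F k + τ * C 0F k)
        (λ j → trans (row₀ j) (sym (comb-δ+ 0F 1F j))) (λ j → trans (row₁ j) (sym (comb-δ+ 1F 0F j))) rest)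
      (*-congʳ (+-congˡ (-‿cong (*-cong (+-identityˡ _) (+-identityˡ _)))))
      where
      comb-δ+ : ∀ i i′ j → comb B (λ k → δ i k + τ * C i′ k) j ≈ B i j + τ * δ i′ j
      comb-δ+ i i′ j = trans (comb-+ B _ _ j) (+-cong (∑-δ i λ k → B k j) (trans (comb-scale B τ _ j) (*-congˡ (CB≈1 i′ j))))

    -- The matrix `E` has first row e₀ - e₁ and second row the sum of the first two rows of `B`.
    -- Expanding along e₀ - e₁ adds the first two columns, so `E` has the determinant of the
    -- amalgamated matrix whose corner is the sum `d₂` of four entries. Replacing `d₂` by `d` costs
    -- a multiple of the minor without both vertices.
    det-merge : ∀ d → Det (frame d (λ j → B 0F (suc (suc j)) + B 1F (suc (suc j)))
                                   (λ i → B (suc (suc i)) 0F + B (suc (suc i)) 1F)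
                                   (λ i j → B (suc (suc i)) (suc (suc j)))) ≈
                      ((C 0F 0F - C 1F 0F) - (C 0F 1F - C 1F 1F) +
                       (d - (B 0F 0F + B 0F 1F + (B 1F 0F + B 1F 1F))) * (C 0F 0F * C 1F 1F - C 0F 1F * C 1F 0F)) * Det B
    det-merge d = begin
      Det (frame d row col S)
        ≈⟨ det-frame-corner d₂ d row col S ⟩
      Det (frame d₂ row col S) + (d - d₂) * Det S
        ≈⟨ +-cong (trans (sym detE) det-E) (*-congˡ det-minor₀₁) ⟩
      (y 0F * (0# + 1#) - y 1F * (1# + 0#)) * Det B + (d - d₂) * (Δ * Det B)
        ≈⟨ solve 6 (λ p q z e f g → (p :* (z :+ con 1ℤ) :- q :* (con 1ℤ :+ z)) :* g :+ e :* (f :* g) :=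
                                    (p :- q :+ e :* f) :* g :+ (p :* g :- q :* g) :* z)
                   refl (y 0F) (y 1F) 0# (d - d₂) Δ (Det B) ⟩
      (y 0F - y 1F + (d - d₂) * Δ) * Det B + (y 0F * Det B - y 1F * Det B) * 0#
        ≈⟨ trans (+-congˡ (zeroʳ _)) (+-identityʳ _) ⟩
      (y 0F - y 1F + (d - d₂) * Δ) * Det B ∎
      where
      row : Fin n → Carrier
      row j = B 0F (suc (suc j)) + B 1F (suc (suc j))
      col : Fin n → Carrier
      col i = B (suc (suc i)) 0F + B (suc (suc i)) 1F
      S : Matrix Carrier n
      S i j = B (suc (suc i)) (suc (suc j))
      d₂ Δ : Carrier
      d₂ = B 0F 0F + B 0F 1F + (B 1F 0F + B 1F 1F)
      Δ = C 0F 0F * C 1F 1F - C 0F 1F * C 1F 0F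
      y : Fin (suc (suc n)) → Carrier
      y k = C 0F k - C 1F k
      E : Matrix Carrier (suc (suc n))
      E = (λ j → δ 0F j - δ 1F j) ◁ (λ j → B 0F j + B 1F j) ◁ tail (tail B)
      det-E : Det E ≈ (y 0F * (0# + 1#) - y 1F * (1# + 0#)) * Det B
      det-E = det-rows₀₁ y (λ k → δ 0F k + δ 1F k)
        (λ j → sym (trans (comb-+ B _ _ j) (+-cong (CB≈1 0F j) (trans (comb-neg B _ j) (-‿cong (CB≈1 1F j))))))
        (λ j → sym (trans (comb-+ B _ _ j) (+-cong (∑-δ 0F λ k → B k j) (∑-δ 1F λ k → B k j))))
        (λ i j → refl)
      detE : Det E ≈ Det (frame d₂ row col S)
      detE = begin
        Det E
          ≈⟨ trans (Det-expand E) (trans (∑-suc _) (+-congˡ (∑-supported₀ λ j →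
               trans (*-congˡ (trans (*-congʳ (-‿inverseʳ 0#)) (zeroˡ _))) (zeroʳ _)))) ⟩
        sgn 0F * ((1# - 0#) * Det (minor (tail E) 0F)) + sgn 1F * ((0# - 1#) * Det (minor (tail E) 1F))
          ≈⟨ +-cong
               (trans (*-cong sgn-zero (trans (*-congʳ (trans (+-congˡ -0#≈0#) (+-identityʳ 1#))) (*-identityˡ _))) (*-identityˡ _))
               (trans (*-cong (trans (sgn-suc 0F) (-‿cong sgn-zero)) (*-congʳ (+-identityˡ _)))
                      (solve 1 (λ x → :- con 1ℤ :* (:- con 1ℤ :* x) := x) refl _)) ⟩
        Det (minor (tail E) 0F) + Det (minor (tail E) 1F)
          ≈⟨ det-column-+
               (λ { zero → solve 4 (λ a b c d → (a :+ b) :+ (c :+ d) := c :+ a :+ (d :+ b)) refl (B 0F 1F) (B 1F 1F) (B 0F 0F) (B 1F 0F)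
                  ; (suc i) → +-comm _ _ })
               (λ { zero j → refl ; (suc i) j → refl })
               (λ { zero j → refl ; (suc i) j → refl }) ⟩
        Det (frame d₂ row col S) ∎

-- Walk generating functions as the inverse of I - tM

module Resolvent {c ℓ} (R : CommutativeRing c ℓ) where
  open CommutativeRing R hiding (zero)
  open IntegerImage R using (module Solver)
  open Solver using (solve; _:=_; _:+_; _:*_; _:-_; :-_; con)
  open Determinant R using (∑; ∑-cong; ∑-swap; ∑-+; ∑-neg; *-distribˡ-∑; ∑-permute; δ; δ-sym; ∑-δ)
  open PowerSeries R
  open InverseMatrix seriesRing
  open import Algebra.Properties.Ring ring using (-0#≈0#; -‿distribʳ-*; -‿distribˡ-*; -‿+-comm)
  open import Relation.Binary.Reasoning.Setoid setoid

  pow : ∀ {n} → Matrix Carrier n → ℕ → Matrix Carrier n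
  pow M zero    = δ
  pow M (suc k) i j = ∑ λ l → pow M k i l * M l j

  pow-suc : ∀ {n} (M : Matrix Carrier n) k i j → pow M (suc k) i j ≈ ∑ λ l → M i l * pow M k l j
  pow-suc M zero i j = begin
    ∑ (λ l → δ i l * M l j)   ≈⟨ ∑-δ i (λ l → M l j) ⟩
    M i j                     ≈⟨ ∑-δ j (M i) ⟨
    ∑ (λ l → δ j l * M i l)   ≈⟨ ∑-cong (λ l → trans (*-comm _ _) (*-congˡ (δ-sym j l))) ⟩
    ∑ (λ l → M i l * δ l j)   ∎
  pow-suc M (suc k) i j = begin
    ∑ (λ l → pow M (suc k) i l * M l j)
      ≈⟨ ∑-cong (λ l → trans (*-congʳ (pow-suc M k i l)) (trans (*-comm _ _) (*-distribˡ-∑ (M l j) _))) ⟩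
    ∑ (λ l → ∑ λ h → M l j * (M i h * pow M k h l))
      ≈⟨ ∑-swap _ ⟩
    ∑ (λ h → ∑ λ l → M l j * (M i h * pow M k h l))
      ≈⟨ ∑-cong (λ h → trans (∑-cong λ l → solve 3 (λ a b p → a :* (b :* p) := b :* (p :* a)) refl (M l j) (M i h) _)
                             (sym (*-distribˡ-∑ (M i h) _))) ⟩
    ∑ (λ h → M i h * pow M (suc k) h j) ∎

  pow-sym : ∀ {n} (M : Matrix Carrier n) → (∀ i j → M i j ≈ M j i) → ∀ k i j → pow M k i j ≈ pow M k j i
  pow-sym M M-sym zero    i j = δ-sym i j
  pow-sym M M-sym (suc k) i j = trans
    (∑-cong λ l → trans (*-comm _ _) (*-cong (M-sym l j) (pow-sym M M-sym k i l)))
    (sym (pow-suc M k j i))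

  walks : ∀ {n} → Matrix Carrier n → Matrix Series n
  walks M i j k = pow M k i j

  δ-series-0 : ∀ {n} (i j : Fin n) → S.δ i j 0 ≈ δ i j
  δ-series-0 i j with does (i ≟ j)
  ... | true  = refl
  ... | false = refl

  δ-series-suc : ∀ {n} (i j : Fin n) k → S.δ i j (suc k) ≈ 0#
  δ-series-suc i j k with does (i ≟ j)
  ... | true  = refl
  ... | false = refl

  -- The geometric series: in degree k + 1 the entry of Mᵏ⁺¹ cancels against that of Mᵏ M.
  walks-inverse : ∀ {n} (M : Matrix Carrier n) → LeftInverse (walks M) (resolvent M)
  walks-inverse M i j k = trans (∑-coeff _ k) (trans (∑-cong λ l → conv-comm (walks M i l) (resolvent M l j) k) (coeffs k))
    where
    coeffs : ∀ k → ∑ (λ l → conv (resolvent M l j) (walks M i l) k) ≈ S.δ i j k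
    coeffs zero = begin
      ∑ (λ l → δ l j * δ i l)   ≈⟨ ∑-cong (λ l → *-comm _ _) ⟩
      ∑ (λ l → δ i l * δ l j)   ≈⟨ ∑-δ i (λ l → δ l j) ⟩
      δ i j                     ≈⟨ δ-series-0 i j ⟨
      S.δ i j 0                 ∎
    coeffs (suc k) = begin
      ∑ (λ l → conv (resolvent M l j) (walks M i l) (suc k))
        ≈⟨ ∑-cong (λ l → trans (linear-* _ _ (walks M i l) k) (+-cong (*-congʳ (δ-sym l j))
             (trans (*-comm _ _) (sym (-‿distribʳ-* _ _))))) ⟩
      ∑ (λ l → δ j l * pow M (suc k) i l + - (pow M k i l * M l j))
        ≈⟨ trans (∑-+ _ _) (+-cong (∑-δ j (pow M (suc k) i)) (∑-neg _)) ⟩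
      pow M (suc k) i j - pow M (suc k) i j
        ≈⟨ -‿inverseʳ _ ⟩
      0#
        ≈⟨ δ-series-suc i j k ⟨
      S.δ i j (suc k) ∎

  t· : Carrier → Series
  t· e = linear 0# e

  t·δ : ∀ {n} e (i j : Fin n) → t· e S.* S.δ i j S.≈ linear 0# (e * δ i j)
  t·δ e i j zero    = zeroˡ _
  t·δ e i j (suc k) = trans (linear-* 0# e (S.δ i j) k) (trans (trans (+-congʳ (zeroˡ _)) (+-identityˡ _)) (rest k))
    where
    rest : ∀ k → e * S.δ i j k ≈ linear 0# (e * δ i j) (suc k)
    rest zero    = *-congˡ (δ-series-0 i j)
    rest (suc k) = trans (*-congˡ (δ-series-suc i j k)) (zeroʳ e)

  linear-+ : ∀ a b a′ b′ → linear a b S.+ linear a′ b′ S.≈ linear (a + a′) (b + b′)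
  linear-+ a b a′ b′ zero          = refl
  linear-+ a b a′ b′ (suc zero)    = refl
  linear-+ a b a′ b′ (suc (suc k)) = +-identityˡ 0#

  resolvent-shift : ∀ {n} {M M′ : Matrix Carrier n} e {i j : Fin n} i′ → M′ i j ≈ M i j + e * δ i′ j →
                    resolvent M′ i j S.≈ resolvent M i j S.+ t· (- e) S.* S.δ i′ j
  resolvent-shift e {i} {j} i′ eq = S.sym (S.trans (S.+-congˡ (t·δ (- e) i′ j)) (S.trans (linear-+ _ _ _ _)
    (linear-cong (+-identityʳ _) (sym (trans (-‿cong eq) (trans (sym (-‿+-comm _ _)) (+-congˡ (-‿distribˡ-* _ _))))))))

  resolvent-cong : ∀ {n} {M M′ : Matrix Carrier n} {i j} → M′ i j ≈ M i j → resolvent M′ i j S.≈ resolvent M i j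
  resolvent-cong eq = linear-cong refl (-‿cong eq)

  detSeries-cong : ∀ {n} {M M′ : Matrix Carrier n} → (∀ i j → M i j ≈ M′ i j) → detSeries M S.≈ detSeries M′
  detSeries-cong eq = S.det-cong λ i j → linear-cong refl (-‿cong (eq i j))

  detSeries-minor₀ : ∀ {n} (M : Matrix Carrier (suc n)) →
                     detSeries (λ i j → M (suc i) (suc j)) S.≈ walks M zero zero S.* detSeries M
  detSeries-minor₀ M = det-minor₀ (walks-inverse M)

  detSeries-loop : ∀ {n} {M M′ : Matrix Carrier (suc n)} e → (∀ j → M′ zero j ≈ M zero j + e * δ zero j) →
                   (∀ i j → M′ (suc i) j ≈ M (suc i) j) →
                   detSeries M′ S.≈ (S.1# S.+ t· (- e) S.* walks M zero zero) S.* detSeries M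
  detSeries-loop {M = M} {M′} e row rest = det-loop (walks-inverse M) (t· (- e))
    (λ j → resolvent-shift {M = M} {M′} e zero (row j)) λ i j → resolvent-cong {M = M} {M′} (rest i j)

  detSeries-minor₀₁ : ∀ {n} (M : Matrix Carrier (suc (suc n))) →
                      detSeries (λ i j → M (suc (suc i)) (suc (suc j))) S.≈
                      (walks M 0F 0F S.* walks M 1F 1F S.- walks M 0F 1F S.* walks M 1F 0F) S.* detSeries M
  detSeries-minor₀₁ M = det-minor₀₁ (walks-inverse M)

  detSeries-cross : ∀ {n} {M M′ : Matrix Carrier (suc (suc n))} e →
                    (∀ j → M′ 0F j ≈ M 0F j + e * δ 1F j) → (∀ j → M′ 1F j ≈ M 1F j + e * δ 0F j) →
                    (∀ i j → M′ (suc (suc i)) j ≈ M (suc (suc i)) j) →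
                    detSeries M′ S.≈
                    ((S.1# S.+ t· (- e) S.* walks M 1F 0F) S.* (S.1# S.+ t· (- e) S.* walks M 0F 1F) S.-
                     (t· (- e) S.* walks M 1F 1F) S.* (t· (- e) S.* walks M 0F 0F)) S.* detSeries M
  detSeries-cross {M = M} {M′} e row₀ row₁ rest = det-cross (walks-inverse M) (t· (- e))
    (λ j → resolvent-shift {M = M} {M′} e 1F (row₀ j)) (λ j → resolvent-shift {M = M} {M′} e 0F (row₁ j))
    λ i j → resolvent-cong {M = M} {M′} (rest i j)

  linear-neg-+ : ∀ a b → linear 0# (- (a + b)) S.≈ linear 0# (- a) S.+ linear 0# (- b)
  linear-neg-+ a b = S.sym (S.trans (linear-+ _ _ _ _) (linear-cong (+-identityʳ 0#) (-‿+-comm a b)))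

  detSeries-merge : ∀ {n} (M : Matrix Carrier (suc (suc n))) a → M 0F 0F ≈ 0# → M 1F 1F ≈ 0# →
                    M 0F 1F ≈ a → M 1F 0F ≈ a →
                    detSeries (frame a (λ j → M 0F (suc (suc j)) + M 1F (suc (suc j)))
                                       (λ i → M (suc (suc i)) 0F + M (suc (suc i)) 1F)
                                       (λ i j → M (suc (suc i)) (suc (suc j)))) S.≈
                    ((walks M 0F 0F S.- walks M 1F 0F) S.- (walks M 0F 1F S.- walks M 1F 1F) S.-
                     linear 1# (- a) S.* (walks M 0F 0F S.* walks M 1F 1F S.- walks M 0F 1F S.* walks M 1F 0F)) S.* detSeries M
  detSeries-merge M a M₀₀ M₁₁ M₀₁ M₁₀ = S.trans
    (S.det-cong λ { zero zero → S.refl ; zero (suc j) → linear-neg-+ _ _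
                  ; (suc i) zero → linear-neg-+ _ _ ; (suc i) (suc j) → S.refl })
    (S.trans (det-merge (walks-inverse M) (linear 1# (- a)))
    (S.*-congʳ (S.+-congˡ (S.trans (S.*-congʳ corner) (S.sym (-ˢ‿distribˡ-* (linear 1# (- a)) _))))))
    where
    open import Algebra.Properties.Ring S.ring using () renaming (-‿distribˡ-* to -ˢ‿distribˡ-*)
    B = resolvent M
    -- The four entries of I - tM at the merged vertices add up to 2 - 2at, twice the new corner 1 -
    -- at.
    corner : linear 1# (- a) S.- (B 0F 0F S.+ B 0F 1F S.+ (B 1F 0F S.+ B 1F 1F)) S.≈ S.- linear 1# (- a)
    corner zero = trans (+-congˡ (-‿cong (+-cong (+-identityʳ 1#) (+-identityˡ 1#))))
      (solve 1 (λ x → x :- (x :+ x) := :- x) refl 1#)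
    corner (suc zero) = trans (+-congˡ (-‿cong (+-cong
        (trans (+-cong (trans (-‿cong M₀₀) -0#≈0#) (-‿cong M₀₁)) (+-identityˡ _))
        (trans (+-cong (-‿cong M₁₀) (trans (-‿cong M₁₁) -0#≈0#)) (+-identityʳ _)))))
      (solve 1 (λ x → x :- (x :+ x) := :- x) refl (- a))
    corner (suc (suc k)) = trans (+-congˡ (-‿cong (trans (+-cong (+-identityʳ 0#) (+-identityʳ 0#)) (+-identityʳ 0#))))
      (+-identityˡ _)

  -- The new row -t(e_u + e_v) is the combination -t(C_u + C_v) of the rows of I - tM, so
  -- `det-frame` applies.
  detSeries-frame : ∀ {n} (M : Matrix Carrier n) (b : Fin n → Carrier) u v → (∀ j → b j ≈ δ u j + δ v j) →
                    detSeries (frame 0# b b M) S.≈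
                    (S.1# S.- t· (- 1#) S.* t· (- 1#) S.*
                      ((walks M u u S.+ walks M v u) S.+ (walks M u v S.+ walks M v v))) S.* detSeries M
  detSeries-frame {n} M b u v b≈ = S.trans
    (S.det-cong λ { zero zero → corner ; zero (suc j) → edge j ; (suc i) zero → edge i ; (suc i) (suc j) → S.refl })
    (S.trans (det-frame S.1# r r (resolvent M) y yB≈r) (S.*-congʳ (S.+-congˡ (S.-‿cong y·r))))
    where
    τ = t· (- 1#)
    r y : Fin n → Series
    r j = τ S.* (S.δ u j S.+ S.δ v j)
    y k = τ S.* (walks M u k S.+ walks M v k)

    corner : linear 1# (- 0#) S.≈ S.1#
    corner zero          = refl
    corner (suc zero)    = -0#≈0#
    corner (suc (suc k)) = refl

    edge : ∀ j → linear 0# (- b j) S.≈ r j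
    edge j = S.sym (S.trans (S.distribˡ τ _ _) (S.trans (S.+-cong (t·δ (- 1#) u j) (t·δ (- 1#) v j))
      (S.trans (linear-+ _ _ _ _) (linear-cong (+-identityʳ 0#) (trans
        (solve 2 (λ x y → :- con 1ℤ :* x :+ :- con 1ℤ :* y := :- (x :+ y)) refl (δ u j) (δ v j))
        (-‿cong (sym (b≈ j))))))))

    yB≈r : ∀ j → comb (resolvent M) y j S.≈ r j
    yB≈r j = S.trans (comb-scale (resolvent M) τ _ j) (S.*-congˡ (S.trans (comb-+ (resolvent M) _ _ j)
      (S.+-cong (walks-inverse M u j) (walks-inverse M v j))))

    y·r : S.∑ (λ k → y k S.* r k) S.≈ τ S.* τ S.* ((walks M u u S.+ walks M v u) S.+ (walks M u v S.+ walks M v v))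
    y·r = S.trans (S.∑-cong λ k → regroup τ (walks M u k S.+ walks M v k) (S.δ u k) (S.δ v k))
      (S.trans (S.sym (S.*-distribˡ-∑ (τ S.* τ) _)) (S.*-congˡ
        (S.trans (S.∑-+ _ _) (S.+-cong (S.∑-δ u _) (S.∑-δ v _)))))
      where
      open IntegerImage.Solver seriesRing using () renaming (solve to solveˢ; _:=_ to _:=ˢ_; _:+_ to _:+ˢ_; _:*_ to _:*ˢ_)
      regroup : ∀ t w p q → (t S.* w) S.* (t S.* (p S.+ q)) S.≈ (t S.* t) S.* (p S.* w S.+ q S.* w)
      regroup = solveˢ 4 (λ t w p q → (t :*ˢ w) :*ˢ (t :*ˢ (p :+ˢ q)) :=ˢ (t :*ˢ t) :*ˢ (p :*ˢ w :+ˢ q :*ˢ w)) S.refl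

  module _ {m n} (π : Permutation m n) (M : Matrix Carrier n) where
    private
      f : Fin m → Fin n
      f i = π ⟨$⟩ʳ i

      f-injective : ∀ {i j} → f i ≡ f j → i ≡ j
      f-injective = Injection.injective (Inverse⇒Injection π)

    relabel : Matrix Carrier m
    relabel i j = M (f i) (f j)

    δ-relabel : ∀ i j → δ (f i) (f j) ≈ δ i j
    δ-relabel i j with i ≟ j | f i ≟ f j
    ... | yes _   | yes _     = refl
    ... | no  _   | no  _     = refl
    ... | yes i≡j | no  fi≢fj = contradiction (≡.cong f i≡j) fi≢fj
    ... | no  i≢j | yes fi≡fj = contradiction (f-injective fi≡fj) i≢j

    pow-relabel : ∀ k i j → pow relabel k i j ≈ pow M k (f i) (f j)
    pow-relabel zero    i j = sym (δ-relabel i j)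
    pow-relabel (suc k) i j = trans (∑-cong λ l → *-congʳ (pow-relabel k i l)) (sym (∑-permute _ π))

    detSeries-relabel : detSeries relabel S.≈ detSeries M
    detSeries-relabel = S.trans
      (S.det-cong λ i j → linear-cong (sym (δ-relabel i j)) refl)
      (S.det-relabel f (↔⇒≡ π) f-injective (resolvent M))

-- With C = (I − tM)⁻¹, p = C₀₀ = C₁₁ and x = C₀₁ = C₁₀, the factors by which
-- det (I − tM) changes under the four perturbations of a pair of vertices.
module PairFactors {c ℓ} (R : CommutativeRing c ℓ) where
  open CommutativeRing R hiding (zero)
  open IntegerImage.Solver R using (solve; _:=_; _:+_; _:*_; _:-_; :-_; con)

  minorFactor : (p x : Carrier) → Carrier
  minorFactor p x = p * p - x * x

  crossFactor : (τ p x : Carrier) → Carrier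
  crossFactor τ p x = (1# + τ * x) * (1# + τ * x) - (τ * p) * (τ * p)

  mergeFactor : (d p x : Carrier) → Carrier
  mergeFactor d p x = (p - x) - (x - p) - d * (p * p - x * x)

  frameFactor : (τ p x : Carrier) → Carrier
  frameFactor τ p x = 1# - τ * τ * ((p + x) + (x + p))

  minorFactor-difference : ∀ p x y → minorFactor p x - minorFactor p y ≈ (x + y) * (y - x)
  minorFactor-difference = solve 3 (λ p x y → (p :* p :- x :* x) :- (p :* p :- y :* y) := (x :+ y) :* (y :- x)) refl

  crossFactor-difference : ∀ τ p x y →
    crossFactor τ p x - crossFactor τ p y ≈ - τ * ((1# + 1#) + τ * (x + y)) * (y - x)
  crossFactor-difference = solve 4 (λ τ p x y →
    ((con 1ℤ :+ τ :* x) :* (con 1ℤ :+ τ :* x) :- (τ :* p) :* (τ :* p)) :-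
    ((con 1ℤ :+ τ :* y) :* (con 1ℤ :+ τ :* y) :- (τ :* p) :* (τ :* p)) :=
    :- τ :* ((con 1ℤ :+ con 1ℤ) :+ τ :* (x :+ y)) :* (y :- x)) refl

  mergeFactor-difference : ∀ d p x y →
    mergeFactor d p x - mergeFactor d p y ≈ ((1# + 1#) - d * (x + y)) * (y - x)
  mergeFactor-difference = solve 4 (λ d p x y →
    ((p :- x) :- (x :- p) :- d :* (p :* p :- x :* x)) :- ((p :- y) :- (y :- p) :- d :* (p :* p :- y :* y)) :=
    ((con 1ℤ :+ con 1ℤ) :- d :* (x :+ y)) :* (y :- x)) refl

  frameFactor-difference : ∀ τ p x y →
    frameFactor τ p x - frameFactor τ p y ≈ τ * τ * (1# + 1#) * (y - x)
  frameFactor-difference = solve 4 (λ τ p x y →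
    (con 1ℤ :- τ :* τ :* ((p :+ x) :+ (x :+ p))) :- (con 1ℤ :- τ :* τ :* ((p :+ y) :+ (y :+ p))) :=
    τ :* τ :* (con 1ℤ :+ con 1ℤ) :* (y :- x)) refl

  loop-difference : ∀ τ x y → (1# + τ * x) - (1# + τ * y) ≈ - τ * (y - x)
  loop-difference = solve 3 (λ τ x y → (con 1ℤ :+ τ :* x) :- (con 1ℤ :+ τ :* y) := :- τ :* (y :- x)) refl

  -- Gives multiplication by a common series the same shape as the other differences, so that
  -- `cancel` also divides out det (I - tA).
  product-difference : ∀ d x y → x * d - y * d ≈ - d * (y - x)
  product-difference = solve 3 (λ d x y → x :* d :- y :* d := :- d :* (y :- x)) refl

  minorFactor-cong : ∀ {p x y} → x ≈ y → minorFactor p x ≈ minorFactor p y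
  minorFactor-cong x≈y = +-congˡ (-‿cong (*-cong x≈y x≈y))

  crossFactor-cong : ∀ {τ p x y} → x ≈ y → crossFactor τ p x ≈ crossFactor τ p y
  crossFactor-cong x≈y = +-congʳ (*-cong (+-congˡ (*-congˡ x≈y)) (+-congˡ (*-congˡ x≈y)))

  loopFactor-of : ∀ {d d′ c x} → d ≈ d′ → c ≈ x → ∀ τ → (1# + τ * c) * d ≈ (1# + τ * x) * d′
  loopFactor-of d≈ c≈x τ = *-cong (+-congˡ (*-congˡ c≈x)) d≈

  module _ {d d′ c₀₀ c₁₁ c₀₁ c₁₀ p x} (d≈ : d ≈ d′) (c₀₀≈ : c₀₀ ≈ p) (c₁₁≈ : c₁₁ ≈ p) (c₀₁≈ : c₀₁ ≈ x) (c₁₀≈ : c₁₀ ≈ x) where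

    minorFactor-of : (c₀₀ * c₁₁ - c₀₁ * c₁₀) * d ≈ minorFactor p x * d′
    minorFactor-of = *-cong (+-cong (*-cong c₀₀≈ c₁₁≈) (-‿cong (*-cong c₀₁≈ c₁₀≈))) d≈

    crossFactor-of : ∀ τ → ((1# + τ * c₁₀) * (1# + τ * c₀₁) - (τ * c₁₁) * (τ * c₀₀)) * d ≈ crossFactor τ p x * d′
    crossFactor-of τ = *-cong (+-cong
      (*-cong (+-congˡ (*-congˡ c₁₀≈)) (+-congˡ (*-congˡ c₀₁≈)))
      (-‿cong (*-cong (*-congˡ c₁₁≈) (*-congˡ c₀₀≈)))) d≈

    mergeFactor-of : ∀ e → ((c₀₀ - c₁₀) - (c₀₁ - c₁₁) - e * (c₀₀ * c₁₁ - c₀₁ * c₁₀)) * d ≈ mergeFactor e p x * d′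
    mergeFactor-of e = *-cong (+-cong
      (+-cong (+-cong c₀₀≈ (-‿cong c₁₀≈)) (-‿cong (+-cong c₀₁≈ (-‿cong c₁₁≈))))
      (-‿cong (*-congˡ (+-cong (*-cong c₀₀≈ c₁₁≈) (-‿cong (*-cong c₀₁≈ c₁₀≈)))))) d≈

    frameFactor-of : ∀ τ → (1# - τ * τ * ((c₀₀ + c₁₀) + (c₀₁ + c₁₁))) * d ≈ frameFactor τ p x * d′
    frameFactor-of τ = *-cong (+-congˡ (-‿cong (*-congˡ (+-cong (+-cong c₀₀≈ c₁₀≈) (+-cong c₀₁≈ c₁₁≈))))) d≈

-- Cancellation in ℤ⟦t⟧

open ℤ⟦t⟧

-- Says that `s` has order exactly `h`. The order is given explicitly because it cannot be searched
-- for in a series merely known to be nonzero.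
Leading : ℕ → Series → Set
Leading h s = (∀ i → i < h → s i ≡ 0ℤ) × s h ≢ 0ℤ

-- The leading zeros of `s` are shifted away until its constant term is nonzero. Then ℤ having no
-- zero divisors forces the constant term of `d` to vanish, and the same argument applies to `d`
-- shifted by one.
annihilates : ∀ {h s d} → Leading h s → (∀ k → conv s d k ≡ 0ℤ) → ∀ k → d k ≡ 0ℤ
annihilates {zero} {s} {d} (_ , s₀≢0) sd≡0 zero with ℤₚ.i*j≡0⇒i≡0∨j≡0 (s 0) (sd≡0 0)
... | inj₁ s₀≡0 = contradiction s₀≡0 s₀≢0
... | inj₂ d₀≡0 = d₀≡0
annihilates {zero} {s} {d} lead@(_ , s₀≢0) sd≡0 (suc k) =
  annihilates lead (λ i → ≡.trans (≡.sym (≡.trans (≡.cong (ℤ._+ conv s (d ∘ suc) i)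
    (≡.trans (≡.cong (s (suc i) ℤ.*_) (annihilates {d = d} lead sd≡0 zero)) (ℤₚ.*-zeroʳ (s (suc i)))))
    (ℤₚ.+-identityˡ _))) (≡.trans (≡.sym (conv-sucʳ s d i)) (sd≡0 (suc i)))) k
annihilates {suc h} {s} {d} (low , sₕ≢0) sd≡0 =
  annihilates {h} ((λ i i<h → low (suc i) (s≤s i<h)) , sₕ≢0) λ i →
    ≡.trans (≡.sym (≡.trans (≡.cong (λ a → a ℤ.* d (suc i) ℤ.+ conv (s ∘ suc) d i) (low 0 (s≤s z≤n))) (ℤₚ.+-identityˡ _)))
            (sd≡0 (suc i))

cancel : ∀ {h s f g x y} → Leading h s → f S.- g S.≈ s S.* (y S.- x) → f S.≈ g → x S.≈ y
cancel {f = f} {g} {x} {y} lead diff f≈g k = ≡.sym (ℤₚ.i-j≡0⇒i≡j (y k) (x k) (annihilates lead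
  (λ i → ≡.trans (≡.sym (diff i)) (ℤₚ.i≡j⇒i-j≡0 (f≈g i))) k))

open ≡ using (refl; sym; trans; cong; cong₂; subst)
open import Data.Integer.Base using (_+_; _*_)
open import Algebra.Properties.Ring ℤₚ.+-*-ring using (+-cancelˡ)
open ℤ⟦t⟧
open Determinant ℤₚ.+-*-commutativeRing
  using (∑; ∑-suc; ∑-cong; ∑-zero; ∑-swap; ∑-+; *-distribˡ-∑; δ; δ-sym; ∑-δ)
open Resolvent ℤₚ.+-*-commutativeRing
open PairFactors seriesRing

-- Walks and distances

∑-nonneg : ∀ {n} {f : Fin n → ℤ} → (∀ i → 0ℤ ℤ.≤ f i) → 0ℤ ℤ.≤ ∑ f
∑-nonneg {zero}  f≥0 = ℤₚ.≤-reflexive (sym (∑-zero λ ()))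
∑-nonneg {suc n} f≥0 = subst (0ℤ ℤ.≤_) (sym (∑-suc _)) (ℤₚ.+-mono-≤ (f≥0 zero) (∑-nonneg (f≥0 ∘ suc)))

term≤∑ : ∀ {n} {f : Fin n → ℤ} → (∀ i → 0ℤ ℤ.≤ f i) → ∀ i → f i ℤ.≤ ∑ f
term≤∑ {suc n} {f} f≥0 i = subst (f i ℤ.≤_) (sym (∑-suc f)) (bound i)
  where
  bound : ∀ i → f i ℤ.≤ f zero + ∑ (λ j → f (suc j))
  bound zero    = subst (ℤ._≤ f zero + ∑ (λ j → f (suc j))) (ℤₚ.+-identityʳ (f zero))
    (ℤₚ.+-monoʳ-≤ (f zero) (∑-nonneg (λ j → f≥0 (suc j))))
  bound (suc i) = ℤₚ.≤-trans (term≤∑ (λ j → f≥0 (suc j)) i)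
    (subst (ℤ._≤ f zero + ∑ (λ j → f (suc j))) (ℤₚ.+-identityˡ _)
      (ℤₚ.+-monoˡ-≤ (∑ (λ j → f (suc j))) (f≥0 zero)))

bit-≥0 : ∀ b → 0ℤ ℤ.≤ bit b
bit-≥0 true  = ℤ.+≤+ z≤n
bit-≥0 false = ℤ.+≤+ z≤n

length-filter : ∀ {p n} {A : Set} {P : A → Set p} (P? : Decidable P) (f : Fin n → A) →
                + length (filter P? (tabulate f)) ≡ ∑ λ x → bit (does (P? (f x)))
length-filter {n = zero}  P? f = sym (∑-zero λ ())
length-filter {n = suc n} P? f with does (P? (f zero)) in eq
... | true  = trans (cong (λ x → 1ℤ + x) (length-filter P? (f ∘ suc)))
  (sym (trans (∑-suc _) (cong (λ b → bit b + ∑ λ x → bit (does (P? (f (suc x))))) eq)))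
... | false = trans (length-filter P? (f ∘ suc))
  (sym (trans (∑-suc _) (trans (cong (λ b → bit b + ∑ λ x → bit (does (P? (f (suc x))))) eq) (ℤₚ.+-identityˡ _))))

_≐_ : ℕ → ℕ → ℤ
m ≐ n = bit (does (m ℕₚ.≟ n))

≐-yes : ∀ {m n} → m ≡ n → m ≐ n ≡ 1ℤ
≐-yes eq = cong bit (dec-true (_ ℕₚ.≟ _) eq)

≐-no : ∀ {m n} → m ≢ n → m ≐ n ≡ 0ℤ
≐-no neq = cong bit (dec-false (_ ℕₚ.≟ _) neq)

∑-select : ∀ {N d} (α : ℕ → ℤ) → d < N → ∑ (λ (j : Fin N) → α (toℕ j) * (d ≐ toℕ j)) ≡ α d
∑-select {suc N} {zero}  α (s≤s z≤n) = trans (∑-suc _)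
  (trans (cong₂ _+_ (ℤₚ.*-identityʳ (α 0)) (∑-zero λ j → ℤₚ.*-zeroʳ (α (suc (toℕ j))))) (ℤₚ.+-identityʳ _))
∑-select {suc N} {suc d} α (s≤s d<N) = trans (∑-suc _)
  (trans (cong₂ _+_ (ℤₚ.*-zeroʳ (α 0)) (∑-select (α ∘ suc) d<N)) (ℤₚ.+-identityˡ _))

∑-select-out : ∀ {N d} (α : ℕ → ℤ) → N ≤ d → ∑ (λ (j : Fin N) → α (toℕ j) * (d ≐ toℕ j)) ≡ 0ℤ
∑-select-out α N≤d = ∑-zero λ j → trans
  (cong (α (toℕ j) *_) (≐-no λ d≡j → ℕₚ.<⇒≢ (ℕₚ.<-≤-trans (toℕ<n j) N≤d) (sym d≡j))) (ℤₚ.*-zeroʳ (α (toℕ j)))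

infixl 7 _⊡_
_⊡_ : ∀ {n} → Matrix ℤ n → Matrix ℤ n → Matrix ℤ n
(M ⊡ N) i j = ∑ λ l → M i l * N l j

⊡-assoc : ∀ {n} (L M N : Matrix ℤ n) i j → ((L ⊡ M) ⊡ N) i j ≡ (L ⊡ (M ⊡ N)) i j
⊡-assoc L M N i j = trans
  (∑-cong λ l → trans (ℤₚ.*-comm _ (N l j)) (*-distribˡ-∑ (N l j) _))
  (trans (∑-swap _) (∑-cong λ h → trans
    (∑-cong λ l → trans (ℤₚ.*-comm (N l j) _) (ℤₚ.*-assoc (L i h) (M h l) (N l j)))
    (sym (*-distribˡ-∑ (L i h) _))))

pow-+ : ∀ {n} (M : Matrix ℤ n) k l i j → (pow M k ⊡ pow M l) i j ≡ pow M (l ℕ.+ k) i j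
pow-+ M k zero    i j = trans (∑-cong λ h → trans (ℤₚ.*-comm (pow M k i h) _) (cong (_* pow M k i h) (δ-sym h j))) (∑-δ j _)
pow-+ M k (suc l) i j = trans (sym (⊡-assoc (pow M k) (pow M l) M i j))
  (∑-cong λ h → cong (_* M h j) (pow-+ M k l i h))

module Distances {n} (G : Graph n) (conn : Connected G) where
  open Graph G using (adj; irrefl) renaming (sym to adj-sym)

  A : Matrix ℤ n
  A = adjacency G

  A-sym : ∀ u v → A u v ≡ A v u
  A-sym u v = cong bit (adj-sym u v)

  d : Fin n → Fin n → ℕ
  d = ∂ G conn

  d-walk : ∀ u v → Walk G u v (d u v)
  d-walk u v = proj₁ (proj₂ (least (walk? G u v) (conn u v)))

  d-min : ∀ {u v k} → Walk G u v k → d u v ≤ k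
  d-min {u} {v} {k} = proj₂ (proj₂ (least (walk? G u v) (conn u v))) k

  walk-snoc : ∀ {u v w k} → Walk G u v k → T (adj v w) → Walk G u w (suc k)
  walk-snoc []      e = e ∷ []
  walk-snoc (f ∷ p) e = f ∷ walk-snoc p e

  walk-reverse : ∀ {u v k} → Walk G u v k → Walk G v u k
  walk-reverse [] = []
  walk-reverse (_∷_ {u} {w} e p) = walk-snoc (walk-reverse p) (subst T (adj-sym u w) e)

  d-sym : ∀ u v → d u v ≡ d v u
  d-sym u v = ℕₚ.≤-antisym (d-min (walk-reverse (d-walk v u))) (d-min (walk-reverse (d-walk u v)))

  d-refl : ∀ u → d u u ≡ 0
  d-refl u = ℕₚ.n≤0⇒n≡0 (d-min {u} {u} [])

  d≡0 : ∀ {u v} → d u v ≡ 0 → u ≡ v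
  d≡0 {u} {v} eq with d u v | d-walk u v
  d≡0 refl | .0 | [] = refl

  d≡1⇒adj : ∀ {u v} → d u v ≡ 1 → adj u v ≡ true
  d≡1⇒adj {u} {v} eq with d u v | d-walk u v
  d≡1⇒adj refl | .1 | e ∷ [] = Equivalence.to T-≡ e

  adj⇒d≡1 : ∀ {u v} → adj u v ≡ true → d u v ≡ 1
  adj⇒d≡1 {u} {v} uv with d u v in eq | d-min {u} {v} {1} (subst T (sym uv) _ ∷ [])
  ... | zero  | _ = contradiction (trans (sym uv) (trans (cong (adj u) (sym (d≡0 eq))) (irrefl u))) λ ()
  ... | suc zero | _ = refl
  ... | suc (suc _) | s≤s ()

  A≡≐1 : ∀ u v → A u v ≡ d u v ≐ 1
  A≡≐1 u v with adj u v in uv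
  ... | true  = sym (≐-yes (adj⇒d≡1 uv))
  ... | false = sym (≐-no λ eq → contradiction (trans (sym uv) (d≡1⇒adj eq)) λ ())

  pow-≥0 : ∀ k u v → 0ℤ ℤ.≤ pow A k u v
  term-≥0 : ∀ k u v w → 0ℤ ℤ.≤ A u w * pow A k w v
  term-≥0 k u v w with adj u w
  ... | true  = subst (0ℤ ℤ.≤_) (sym (ℤₚ.*-identityˡ _)) (pow-≥0 k w v)
  ... | false = ℤ.+≤+ z≤n
  pow-≥0 zero    u v = bit-≥0 (does (u ≟ v))
  pow-≥0 (suc k) u v = subst (0ℤ ℤ.≤_) (sym (pow-suc A k u v)) (∑-nonneg (term-≥0 k u v))

  pow-walk : ∀ {u v k} → Walk G u v k → 0ℤ ℤ.< pow A k u v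
  pow-walk {u} [] = subst (0ℤ ℤ.<_) (sym (cong bit (dec-true (u ≟ u) refl))) (ℤ.+<+ (s≤s z≤n))
  pow-walk {u} {v} {suc k} (_∷_ {w = w} e p) = ℤₚ.<-≤-trans (pow-walk p)
    (ℤₚ.≤-trans (ℤₚ.≤-reflexive (sym (trans (cong (λ b → bit b * pow A k w v) (Equivalence.to T-≡ e)) (ℤₚ.*-identityˡ _))))
    (ℤₚ.≤-trans (term≤∑ (term-≥0 k u v) w) (ℤₚ.≤-reflexive (sym (pow-suc A k u v)))))

  pow-no-walk : ∀ k {u v} → ¬ Walk G u v k → pow A k u v ≡ 0ℤ
  pow-no-walk zero    {u} {v} ¬p = cong bit (dec-false (u ≟ v) λ { refl → ¬p [] })
  pow-no-walk (suc k) {u} {v} ¬p = trans (pow-suc A k u v) (∑-zero term)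
    where
    term : ∀ w → A u w * pow A k w v ≡ 0ℤ
    term w with adj u w in uw
    ... | true  = trans (ℤₚ.*-identityˡ _) (pow-no-walk k λ p → ¬p (subst T (sym uw) _ ∷ p))
    ... | false = refl

  pow-below : ∀ {k u v} → k < d u v → pow A k u v ≡ 0ℤ
  pow-below k<d = pow-no-walk _ λ p → ℕₚ.<⇒≱ k<d (d-min p)

  pow-at : ∀ u v → 0ℤ ℤ.< pow A (d u v) u v
  pow-at u v = pow-walk (d-walk u v)

  DistanceConstant : Matrix ℤ n → Set
  DistanceConstant M = ∀ u v w z → d u v ≡ d w z → M u v ≡ M w z

  profile : ∀ {M} → DistanceConstant M → ∃ λ α → ∀ u v → M u v ≡ α (d u v)
  profile {M} const = α , λ u v → value u v
    where
    pair? : ∀ k → Dec (∃ λ u → ∃ λ v → d u v ≡ k)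
    pair? k = any? λ u → any? λ v → d u v ℕₚ.≟ k
    α : ℕ → ℤ
    α k with pair? k
    ... | yes (u , v , _) = M u v
    -- Default for distances that do not occur; `value` constrains `α` only at the others.
    ... | no  _           = 0ℤ
    value : ∀ u v → M u v ≡ α (d u v)
    value u v with pair? (d u v)
    ... | yes (w , z , eq) = const u v w z (sym eq)
    ... | no  ¬pair        = contradiction (u , v , refl) ¬pair

  count-∑ : ∀ i j u v → + countAt G conn i j u v ≡ ∑ λ x → (d u x ≐ i) * (d v x ≐ j)
  count-∑ i j u v = trans (length-filter (λ x → (d u x ℕₚ.≟ i) ×-dec (d v x ℕₚ.≟ j)) id) (∑-cong λ x → both (does (d u x ℕₚ.≟ i)) _)
    where
    both : ∀ a b → bit (a ∧ b) ≡ bit a * bit b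
    both true  b = sym (ℤₚ.*-identityˡ (bit b))
    both false b = refl

  -- Sorting the vertices x by their distance j from v turns the sum into a combination of the
  -- numbers `countAt`; the bound `D` makes the range of j finite.
  distanceRegular⇒∑ : ∀ {D} → (∀ u v → d u v ≤ D) → DistanceRegular G conn → ∀ i (α : ℕ → ℤ) →
                      DistanceConstant λ u v → ∑ λ x → (d u x ≐ i) * α (d v x)
  distanceRegular⇒∑ {D} d≤D dr i α u v w z eq = begin
    ∑ (λ x → (d u x ≐ i) * α (d v x))                                    ≡⟨ expand u v ⟩
    ∑ (λ (j : Fin (suc D)) → α (toℕ j) * + countAt G conn i (toℕ j) u v)
      ≡⟨ ∑-cong (λ j → cong (λ m → α (toℕ j) * + m) (dr i (toℕ j) _ u v w z refl (sym eq))) ⟩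
    ∑ (λ (j : Fin (suc D)) → α (toℕ j) * + countAt G conn i (toℕ j) w z) ≡⟨ expand w z ⟨
    ∑ (λ x → (d w x ≐ i) * α (d z x))                                    ∎
    where
    open ≡.≡-Reasoning
    expand : ∀ u v → ∑ (λ x → (d u x ≐ i) * α (d v x)) ≡
                     ∑ λ (j : Fin (suc D)) → α (toℕ j) * + countAt G conn i (toℕ j) u v
    expand u v = begin
      ∑ (λ x → (d u x ≐ i) * α (d v x))
        ≡⟨ ∑-cong (λ x → trans (cong ((d u x ≐ i) *_) (sym (∑-select α (s≤s (d≤D v x))))) (*-distribˡ-∑ (d u x ≐ i) _)) ⟩
      ∑ (λ x → ∑ λ (j : Fin (suc D)) → (d u x ≐ i) * (α (toℕ j) * (d v x ≐ toℕ j)))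
        ≡⟨ ∑-swap _ ⟩
      ∑ (λ (j : Fin (suc D)) → ∑ λ x → (d u x ≐ i) * (α (toℕ j) * (d v x ≐ toℕ j)))
        ≡⟨ ∑-cong (λ j → trans (∑-cong λ x → x*[y*z] (d u x ≐ i) (α (toℕ j)) _) (trans (sym (*-distribˡ-∑ (α (toℕ j)) _))
             (cong (α (toℕ j) *_) (sym (count-∑ i (toℕ j) u v))))) ⟩
      ∑ (λ (j : Fin (suc D)) → α (toℕ j) * + countAt G conn i (toℕ j) u v) ∎
      where
      x*[y*z] : ∀ x y z → x * (y * z) ≡ y * (x * z)
      x*[y*z] x y z = trans (sym (ℤₚ.*-assoc x y z)) (trans (cong (_* z) (ℤₚ.*-comm x y)) (ℤₚ.*-assoc y x z))

  -- Splitting off the first edge sums, over the neighbours x of u, a function of d v x that the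
  -- induction hypothesis provides. Adjacency being distance 1, this is the previous lemma for
  -- `i = 1`.
  distanceRegular⇒pow : ∀ {D} → (∀ u v → d u v ≤ D) → DistanceRegular G conn → ∀ k → DistanceConstant (pow A k)
  distanceRegular⇒pow d≤D dr zero u v w z eq = cong bit (does-⇔ (mk⇔
    (λ u≡v → d≡0 (trans (sym eq) (trans (cong (d u) (sym u≡v)) (d-refl u))))
    (λ w≡z → d≡0 (trans eq (trans (cong (d w) (sym w≡z)) (d-refl w))))) (u ≟ v) (w ≟ z))
  distanceRegular⇒pow d≤D dr (suc k) u v w z eq = trans (step u v)
    (trans (distanceRegular⇒∑ d≤D dr 1 α u v w z eq) (sym (step w z)))
    where
    α = proj₁ (profile (distanceRegular⇒pow d≤D dr k))
    step : ∀ u v → pow A (suc k) u v ≡ ∑ λ x → (d u x ≐ 1) * α (d v x)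
    step u v = trans (pow-suc A k u v) (∑-cong λ x → cong₂ _*_ (A≡≐1 u x)
      (trans (pow-sym A A-sym k x v) (proj₂ (profile (distanceRegular⇒pow d≤D dr k)) v x)))

  Aₕ : ℕ → Matrix ℤ n
  Aₕ h u v = d u v ≐ h

  module _ (pow-const : ∀ k → DistanceConstant (pow A k)) where

    -- Aᵏ = Σ_{i ≤ k} αᵢ Aᵢ with αₖ ≠ 0 as soon as distance k occurs, so the Aₕ
    -- are successively combinations of powers of A.
    pow-triangular : ∀ h → ∃ λ α → (∀ u v → d u v ≡ h → α h ≢ 0ℤ) ×
                     ∀ u v → pow A h u v ≡ ∑ (λ (i : Fin h) → α (toℕ i) * Aₕ (toℕ i) u v) + α h * Aₕ h u v
    pow-triangular h = α , nonzero , expansion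
      where
      α = proj₁ (profile (pow-const h))
      α-value = proj₂ (profile (pow-const h))
      nonzero : ∀ u v → d u v ≡ h → α h ≢ 0ℤ
      nonzero u v refl αₕ≡0 = ℤₚ.<⇒≢ (pow-at u v) (sym (trans (α-value u v) αₕ≡0))
      expansion : ∀ u v → pow A h u v ≡ ∑ (λ (i : Fin h) → α (toℕ i) * Aₕ (toℕ i) u v) + α h * Aₕ h u v
      expansion u v with ℕₚ.<-cmp (d u v) h
      ... | tri< lt _ _ = trans (α-value u v) (sym (trans (cong₂ _+_ (∑-select α lt)
              (trans (cong (α h *_) (≐-no (ℕₚ.<⇒≢ lt))) (ℤₚ.*-zeroʳ (α h)))) (ℤₚ.+-identityʳ _)))
      ... | tri≈ _ refl _ = trans (α-value u v) (sym (trans (cong₂ _+_ (∑-select-out α ℕₚ.≤-refl)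
              (trans (cong (α h *_) (≐-yes {d u v} refl)) (ℤₚ.*-identityʳ (α h)))) (ℤₚ.+-identityˡ _)))
      ... | tri> _ _ gt = trans (pow-below gt) (sym (trans (cong₂ _+_ (∑-select-out α (ℕₚ.<⇒≤ gt))
              (trans (cong (α h *_) (≐-no (ℕₚ.<⇒≢ gt ∘ sym))) (ℤₚ.*-zeroʳ (α h)))) (ℤₚ.+-identityʳ _)))

    -- The triangular expansion of Aʰ N is solved for Aₕ N by strong induction, cancelling `α h` in
    -- ℤ instead of dividing by it. If distance h does not occur, Aₕ is zero. `N` is general because
    -- both a power of A and a distance matrix are inserted for it.
    Aₕ⊡-const : ∀ N → (∀ k → DistanceConstant (pow A k ⊡ N)) → ∀ h → DistanceConstant (Aₕ h ⊡ N)
    Aₕ⊡-const N powN = <-rec _ step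
      where
      step : ∀ h → (∀ {i} → i < h → DistanceConstant (Aₕ i ⊡ N)) → DistanceConstant (Aₕ h ⊡ N)
      step h rec u v w z eq with any? (λ x → any? λ y → d x y ℕₚ.≟ h)
      ... | no ¬pair = trans (vanish u v) (sym (vanish w z))
        where
        vanish : ∀ u v → (Aₕ h ⊡ N) u v ≡ 0ℤ
        vanish u v = ∑-zero λ x → cong (_* N x v) (≐-no λ d≡h → ¬pair (u , x , d≡h))
      ... | yes (x , y , d≡h) with pow-triangular h
      ... | α , nonzero , expansion = ℤₚ.*-cancelˡ-≡ (α h) _ _ {{ℤ.≢-nonZero (nonzero x y d≡h)}}
        (+-cancelˡ (lower u v) _ _ (begin
          lower u v + α h * (Aₕ h ⊡ N) u v  ≡⟨ expand u v ⟨
          (pow A h ⊡ N) u v                 ≡⟨ powN h u v w z eq ⟩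
          (pow A h ⊡ N) w z                 ≡⟨ expand w z ⟩
          lower w z + α h * (Aₕ h ⊡ N) w z  ≡⟨ cong (_+ α h * (Aₕ h ⊡ N) w z) (∑-cong λ i →
                                                 cong (α (toℕ i) *_) (rec (toℕ<n i) u v w z eq)) ⟨
          lower u v + α h * (Aₕ h ⊡ N) w z  ∎))
        where
        open ≡.≡-Reasoning
        lower : Matrix ℤ n
        lower u v = ∑ λ (i : Fin h) → α (toℕ i) * (Aₕ (toℕ i) ⊡ N) u v
        scaled : ∀ a i u v → ∑ (λ x → N x v * (a * Aₕ i u x)) ≡ a * (Aₕ i ⊡ N) u v
        scaled a i u v = trans (∑-cong λ x → trans (ℤₚ.*-comm (N x v) _) (ℤₚ.*-assoc a (Aₕ i u x) (N x v)))
                               (sym (*-distribˡ-∑ a _))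
        expand : ∀ u v → (pow A h ⊡ N) u v ≡ lower u v + α h * (Aₕ h ⊡ N) u v
        expand u v = begin
          ∑ (λ x → pow A h u x * N x v)
            ≡⟨ ∑-cong (λ x → trans (cong (_* N x v) (expansion u x)) (trans (ℤₚ.*-comm _ (N x v))
                 (trans (ℤₚ.*-distribˡ-+ (N x v) _ _) (cong (_+ N x v * (α h * Aₕ h u x)) (*-distribˡ-∑ (N x v) _))))) ⟩
          ∑ (λ x → ∑ (λ (i : Fin h) → N x v * (α (toℕ i) * Aₕ (toℕ i) u x)) + N x v * (α h * Aₕ h u x))
            ≡⟨ trans (∑-+ _ _) (cong₂ _+_ (trans (∑-swap _) (∑-cong λ i → scaled (α (toℕ i)) (toℕ i) u v)) (scaled (α h) h u v)) ⟩
          lower u v + α h * (Aₕ h ⊡ N) u v ∎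

    -- `Aₕ⊡-const` is used twice. With N = Aᵏ it shows that Aⱼ Aᵏ depends only on the distance;
    -- transposing gives the same for Aᵏ Aⱼ, which is the hypothesis for N = Aⱼ.
    pow⇒distanceRegular : DistanceRegular G conn
    pow⇒distanceRegular i j k u v w z refl eq = ℤₚ.+-injective (trans (count u v)
      (trans (Aₕ⊡-const (Aₕ j) pow⊡Aₕ i u v w z (sym eq)) (sym (count w z))))
      where
      count : ∀ u v → + countAt G conn i j u v ≡ (Aₕ i ⊡ Aₕ j) u v
      count u v = trans (count-∑ i j u v) (∑-cong λ x → cong (λ m → (d u x ≐ i) * (m ≐ j)) (d-sym v x))
      swap : ∀ k u v → (pow A k ⊡ Aₕ j) u v ≡ (Aₕ j ⊡ pow A k) v u
      swap k u v = ∑-cong λ x → trans (ℤₚ.*-comm (pow A k u x) _)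
        (cong₂ _*_ (cong (_≐ j) (d-sym x v)) (pow-sym A A-sym k u x))
      pow⊡Aₕ : ∀ k → DistanceConstant (pow A k ⊡ Aₕ j)
      pow⊡Aₕ k u v w z eq = trans (swap k u v) (trans
        (Aₕ⊡-const (pow A k) (λ l u v w z eq → trans (pow-+ A l k u v) (trans (pow-const (k ℕ.+ l) u v w z eq) (sym (pow-+ A l k w z))))
          j v u z w (trans (d-sym v u) (trans eq (d-sym w z))))
        (sym (swap k w z)))

-- Determinants of perturbed graphs

lookup-injective : ∀ {A : Set} {xs : List A} → Unique xs → ∀ i j → lookup xs i ≡ lookup xs j → i ≡ j
lookup-injective (x∉ ∷ xs!) zero    zero    eq = refl
lookup-injective (x∉ ∷ xs!) zero    (suc j) eq = contradiction eq (All.lookup x∉ (∈-lookup j))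
lookup-injective (x∉ ∷ xs!) (suc i) zero    eq = contradiction (sym eq) (All.lookup x∉ (∈-lookup i))
lookup-injective (x∉ ∷ xs!) (suc i) (suc j) eq = cong suc (lookup-injective xs! i j eq)

enumeration : ∀ {n} (xs : List (Fin n)) → Unique xs → (∀ x → x ∈ xs) → Permutation (length xs) n
enumeration xs xs! x∈xs = permutation (lookup xs) (λ x → Any.index (x∈xs x))
  (λ x → sym (lookup-index (x∈xs x)))
  (λ i → lookup-injective xs! _ i (sym (lookup-index (x∈xs (lookup xs i)))))

module _ {n} (u v : Fin n) where

  others-outside : All (λ x → x ≢ u × x ≢ v) (others u v)
  others-outside = all-filter (λ x → ¬? (x ≟ u) ×-dec ¬? (x ≟ v)) (allFin n)

  others-unique : Unique (others u v)
  others-unique = filter⁺ (λ x → ¬? (x ≟ u) ×-dec ¬? (x ≟ v)) (allFin⁺ n)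

  ∈-others : ∀ {x} → x ≢ u → x ≢ v → x ∈ others u v
  ∈-others x≢u x≢v = ∈-filter⁺ (λ x → ¬? (x ≟ u) ×-dec ¬? (x ≟ v)) (∈-allFin _) (x≢u , x≢v)

  -- The remaining vertices keep the order of `others`, the list by which `remove` is indexed. The
  -- lower right block of the relabelled adjacency matrix is therefore `remove G u v` by
  -- computation.
  vertexFirst : u ≡ v → Permutation (suc (length (others u v))) n
  vertexFirst u≡v = enumeration (u ∷ others u v)
    (All.map (λ (x≢u , _) u≡x → x≢u (sym u≡x)) others-outside ∷ others-unique) complete
    where
    complete : ∀ x → x ∈ u ∷ others u v
    complete x with x ≟ u
    ... | yes x≡u = here x≡u
    ... | no  x≢u = there (∈-others x≢u λ x≡v → x≢u (trans x≡v (sym u≡v)))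

  pairFirst : u ≢ v → Permutation (suc (suc (length (others u v)))) n
  pairFirst u≢v = enumeration (u ∷ v ∷ others u v)
    ((u≢v ∷ All.map (λ (x≢u , _) u≡x → x≢u (sym u≡x)) others-outside) ∷
     All.map (λ (_ , x≢v) v≡x → x≢v (sym v≡x)) others-outside ∷ others-unique) complete
    where
    complete : ∀ x → x ∈ u ∷ v ∷ others u v
    complete x with x ≟ u | x ≟ v
    ... | yes x≡u | _       = here x≡u
    ... | no  x≢u | yes x≡v = there (here x≡v)
    ... | no  x≢u | no  x≢v = there (there (∈-others x≢u x≢v))

module Perturbation {n} (G : Graph n) where
  open Graph G using (adj; irrefl) renaming (sym to adj-sym)

  A : Matrix ℤ n
  A = adjacency G

  C : Matrix Series n
  C = walks A

  -- The change of an entry under a flip: 1 - 2a is 1 for a missing edge and -1 for a present one.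
  flipSign : ℤ → ℤ
  flipSign a = 1ℤ ℤ.- (a + a)

  module _ {u v : Fin n} (u≢v : u ≢ v) where

    flip-first : ∀ y → flip G u v u y ≡ A u y + flipSign (A u v) * δ v y
    flip-first y rewrite dec-true (u ≟ u) refl | dec-false (u ≟ v) u≢v =
      trans (entry y) (cong (λ a → A u y + flipSign (A u v) * a) (δ-sym y v))
      where
      entry : ∀ y → (if does (y ≟ v) ∨ false then bit (not (adj u y)) else bit (adj u y)) ≡
                    A u y + flipSign (A u v) * δ y v
      entry y with y ≟ v
      ... | no  _    = sym (trans (cong (λ a → A u y + a) (ℤₚ.*-zeroʳ (flipSign (A u v)))) (ℤₚ.+-identityʳ _))
      ... | yes refl with adj u v
      ...   | true  = refl
      ...   | false = refl

    flip-second : ∀ y → flip G u v v y ≡ A v y + flipSign (A u v) * δ u y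
    flip-second y rewrite dec-true (v ≟ v) refl | dec-false (v ≟ u) (u≢v ∘ sym) =
      trans (entry y) (cong (λ a → A v y + flipSign (A u v) * a) (δ-sym y u))
      where
      entry : ∀ y → (if does (y ≟ u) then bit (not (adj v y)) else bit (adj v y)) ≡
                    A v y + flipSign (A u v) * δ y u
      entry y with y ≟ u
      ... | no  _    = sym (trans (cong (λ a → A v y + a) (ℤₚ.*-zeroʳ (flipSign (A u v)))) (ℤₚ.+-identityʳ _))
      ... | yes refl rewrite adj-sym u v with adj v u
      ...   | true  = refl
      ...   | false = refl

  flip-rest : ∀ {u v x} → x ≢ u × x ≢ v → ∀ y → flip G u v x y ≡ A x y
  flip-rest {u} {v} {x} (x≢u , x≢v) y rewrite dec-false (x ≟ u) x≢u | dec-false (x ≟ v) x≢v = refl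

  addLoop-first : ∀ u y → addLoop G u u y ≡ A u y + 1ℤ * δ u y
  addLoop-first u y rewrite dec-true (u ≟ u) refl = trans (entry y) (cong (λ a → A u y + 1ℤ * a) (δ-sym y u))
    where
    entry : ∀ y → (if does (y ≟ u) then 1ℤ else A u y) ≡ A u y + 1ℤ * δ y u
    entry y with y ≟ u
    -- Setting the diagonal entry to 1 amounts to adding 1, as it was 0.
    ... | yes refl = cong (λ b → bit b + 1ℤ) (sym (irrefl u))
    ... | no  _    = sym (ℤₚ.+-identityʳ _)

  addLoop-rest : ∀ {u x} → x ≢ u → ∀ y → addLoop G u x y ≡ A x y
  addLoop-rest {u} {x} x≢u y rewrite dec-false (x ≟ u) x≢u = refl

  indicator : ∀ {u v : Fin n} → u ≢ v → ∀ x → bit (does ((x ≟ u) ⊎-dec (x ≟ v))) ≡ δ u x + δ v x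
  indicator {u} {v} u≢v x = trans entry (cong₂ _+_ (δ-sym x u) (δ-sym x v))
    where
    entry : bit (does ((x ≟ u) ⊎-dec (x ≟ v))) ≡ δ x u + δ x v
    entry with x ≟ u | x ≟ v
    ... | yes refl | yes refl = contradiction refl u≢v
    ... | yes _    | no  _    = refl
    ... | no  _    | yes _    = refl
    ... | no  _    | no  _    = refl

  remove₁-size : ∀ u → suc (length (others u u)) ≡ n
  remove₁-size u = ↔⇒≡ (vertexFirst u u refl)

  remove₁-series : ∀ u → detSeries (remove G u u) S.≈ C u u S.* detSeries A
  remove₁-series u = S.trans (detSeries-minor₀ (relabel π A))
    (S.*-cong {walks (relabel π A) zero zero} {C u u} (λ k → pow-relabel π A k zero zero) (detSeries-relabel π A))
    where π = vertexFirst u u refl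

  addLoop-series : ∀ u → detSeries (addLoop G u) S.≈ (S.1# S.+ t· (ℤ.- 1ℤ) S.* C u u) S.* detSeries A
  addLoop-series u = S.trans (S.sym (detSeries-relabel π (addLoop G u)))
    (S.trans (detSeries-loop {M = relabel π A} {relabel π (addLoop G u)} 1ℤ
        (λ j → trans (addLoop-first u _) (cong (λ a → A u (π ⟨$⟩ʳ j) + 1ℤ * a) (δ-relabel π A zero j)))
        (λ i j → addLoop-rest (proj₁ (All.lookup (others-outside u u) (∈-lookup i))) _))
      (loopFactor-of {c = walks (relabel π A) zero zero} {C u u} (detSeries-relabel π A)
        (λ k → pow-relabel π A k zero zero) (t· (ℤ.- 1ℤ))))
    where π = vertexFirst u u refl

  -- A common diagonal `p` removes C u u and C v v from the factors, leaving `C u v` as the only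
  -- entry of C that varies with the pair.
  module Pair {u v : Fin n} (u≢v : u ≢ v) {p : Series} (diag : ∀ w → C w w S.≈ p) where
    private
      π = pairFirst u v u≢v
      M = relabel π A

      c : ∀ i j → walks M i j S.≈ C (π ⟨$⟩ʳ i) (π ⟨$⟩ʳ j)
      c i j k = pow-relabel π A k i j

      c₀₀ : walks M zero zero S.≈ p
      c₀₀ = S.trans (c zero zero) (diag u)
      c₁₁ : walks M (suc zero) (suc zero) S.≈ p
      c₁₁ = S.trans (c (suc zero) (suc zero)) (diag v)
      c₀₁ : walks M zero (suc zero) S.≈ C u v
      c₀₁ = c zero (suc zero)
      C-sym : C v u S.≈ C u v
      C-sym k = pow-sym A (λ x y → cong bit (adj-sym x y)) k v u
      c₁₀ : walks M (suc zero) zero S.≈ C u v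
      c₁₀ = S.trans (c (suc zero) zero) C-sym

    size : suc (suc (length (others u v))) ≡ n
    size = ↔⇒≡ π

    remove-series : detSeries (remove G u v) S.≈ minorFactor p (C u v) S.* detSeries A
    remove-series = S.trans (detSeries-minor₀₁ M)
      (minorFactor-of (detSeries-relabel π A) c₀₀ c₁₁ c₀₁ c₁₀)

    flip-series : detSeries (flip G u v) S.≈
                  crossFactor (t· (ℤ.- flipSign (A u v))) p (C u v) S.* detSeries A
    flip-series = S.trans (S.sym (detSeries-relabel π (flip G u v))) (S.trans
      (detSeries-cross {M = M} {relabel π (flip G u v)} (flipSign (A u v))
        (λ j → trans (flip-first u≢v _) (cong (λ a → A u (π ⟨$⟩ʳ j) + flipSign (A u v) * a) (δ-relabel π A (suc zero) j)))
        (λ j → trans (flip-second u≢v _) (cong (λ a → A v (π ⟨$⟩ʳ j) + flipSign (A u v) * a) (δ-relabel π A zero j)))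
        (λ i j → flip-rest (All.lookup (others-outside u v) (∈-lookup i)) _))
      (crossFactor-of (detSeries-relabel π A) c₀₀ c₁₁ c₀₁ c₁₀ _))

    amalgamate-series : detSeries (amalgamate G u v) S.≈
                        mergeFactor (linear 1ℤ (ℤ.- A u v)) p (C u v) S.* detSeries A
    amalgamate-series = S.trans
      -- The border of `amalgamate` is symmetric by definition, whereas the frame takes its column
      -- from the columns of A; the symmetry of A reconciles them.
      (detSeries-cong {M = amalgamate G u v} λ
        { zero zero → refl ; zero (suc j) → refl
        ; (suc i) zero → cong₂ _+_ (cong bit (adj-sym u _)) (cong bit (adj-sym v _)) ; (suc i) (suc j) → refl })
      (S.trans (detSeries-merge M (A u v) (cong bit (irrefl u)) (cong bit (irrefl v)) refl (cong bit (adj-sym v u)))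
      (mergeFactor-of (detSeries-relabel π A) c₀₀ c₁₁ c₀₁ c₁₀ _))

    addPath-series : detSeries (addPath G u v) S.≈ frameFactor (t· (ℤ.- 1ℤ)) p (C u v) S.* detSeries A
    addPath-series = S.trans
      (detSeries-cong {M = addPath G u v} λ
        { zero zero → refl ; zero (suc j) → refl ; (suc i) zero → refl ; (suc i) (suc j) → refl })
      (S.trans (detSeries-frame A _ u v (indicator u≢v))
      (frameFactor-of {detSeries A} {detSeries A} {C u u} {C v v} {C u v} {C v u} {p} {C u v}
        S.refl (diag u) (diag v) S.refl C-sym (t· (ℤ.- 1ℤ))))

-- Recovering walk counts from determinants, and the equivalences

leading₀ : ∀ {s} → s 0 ≢ 0ℤ → Leading 0 s
leading₀ s₀≢0 = (λ _ ()) , s₀≢0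

module Characterisation {n} (G : Graph n) (conn : Connected G) where
  open Graph G using (adj)
  open Distances G conn
  open Perturbation G hiding (A)

  series⇒pow : (∀ u v w z → d u v ≡ d w z → C u v S.≈ C w z) → ∀ k → DistanceConstant (pow A k)
  series⇒pow C-const k u v w z eq = C-const u v w z eq k

  d≢0 : ∀ u v {h} → d u v ≡ suc h → u ≢ v
  d≢0 u v eq refl = ℕₚ.0≢1+n (trans (sym (d-refl u)) eq)

  d-preserves-≢ : ∀ u v w z → d u v ≡ d w z → u ≢ v → w ≢ z
  d-preserves-≢ u v w z eq u≢v refl = u≢v (d≡0 {u} {v} (trans eq (d-refl w)))

  -- `C u v` has order d u v with a positive coefficient there, so the leading terms of two such
  -- series at equal distance cannot cancel.
  walks-leading : ∀ u v w z → d u v ≡ d w z → Leading (d u v) (C u v S.+ C w z)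
  walks-leading u v w z eq =
    (λ i i<d → cong₂ _+_ (pow-below {u = u} {v} i<d) (pow-below {u = w} {z} (subst (i <_) eq i<d))) ,
    λ sum≡0 → ℤₚ.<⇒≢ (ℤₚ.+-mono-< (pow-at u v) (subst (λ k → 0ℤ ℤ.< pow A k w z) (sym eq) (pow-at w z))) (sym sum≡0)

  cancel-det : ∀ {x y} → x S.* detSeries A S.≈ y S.* detSeries A → x S.≈ y
  cancel-det {x} {y} = cancel {0} {S.- detSeries A}
    (leading₀ λ eq → contradiction (trans (cong ℤ.-_ (sym (detSeries-0 A))) eq) λ ())
    (product-difference (detSeries A) x y)

  remove₁-injective : ∀ {u w} → detSeries (remove G u u) S.≈ detSeries (remove G w w) → C u u S.≈ C w w
  remove₁-injective {u} {w} eq = cancel-det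
    (S.trans (S.sym (remove₁-series u)) (S.trans eq (remove₁-series w)))

  addLoop-injective : ∀ {u w} → detSeries (addLoop G u) S.≈ detSeries (addLoop G w) → C u u S.≈ C w w
  -- With τ = -t the multiplier -τ is t, of order 1.
  addLoop-injective {u} {w} eq = cancel {1} {S.- t· (ℤ.- 1ℤ)}
    ((λ { zero _ → refl ; (suc _) (s≤s ()) }) , λ ())
    (loop-difference (t· (ℤ.- 1ℤ)) (C u u) (C w w))
    (cancel-det (S.trans (S.sym (addLoop-series u)) (S.trans eq (addLoop-series w))))

  module SameDistance (u v w z : Fin n) (u≢v : u ≢ v) (eq : d u v ≡ d w z)
                      (diag : ∀ x → C x x S.≈ C u u) where
    private
      w≢z = d-preserves-≢ u v w z eq u≢v
      p = C u u
      x = C u v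
      y = C w z
      a = A u v

    module UV = Pair u≢v {p} diag
    module WZ = Pair w≢z {p} diag

    -- Adjacency is distance 1, so the two pairs are both edges or both non-edges, and their factors
    -- share the same parameters.
    A-equal : A w z ≡ a
    A-equal = trans (A≡≐1 w z) (trans (cong (_≐ 1) (sym eq)) (sym (A≡≐1 u v)))

    flip-series-wz : detSeries (flip G w z) S.≈ crossFactor (t· (ℤ.- flipSign a)) p y S.* detSeries A
    flip-series-wz = subst
      (λ b → detSeries (flip G w z) S.≈ crossFactor (t· (ℤ.- flipSign b)) p y S.* detSeries A) A-equal WZ.flip-series

    amalgamate-series-wz : detSeries (amalgamate G w z) S.≈ mergeFactor (linear 1ℤ (ℤ.- a)) p y S.* detSeries A
    amalgamate-series-wz = subst
      (λ b → detSeries (amalgamate G w z) S.≈ mergeFactor (linear 1ℤ (ℤ.- b)) p y S.* detSeries A) A-equal WZ.amalgamate-series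

    remove-cong : x S.≈ y → detSeries (remove G u v) S.≈ detSeries (remove G w z)
    remove-cong x≈y = S.trans UV.remove-series (S.trans
      (S.*-congʳ {detSeries A} {minorFactor p x} {minorFactor p y} (minorFactor-cong {p} {x} {y} x≈y)) (S.sym WZ.remove-series))

    flip-cong : x S.≈ y → detSeries (flip G u v) S.≈ detSeries (flip G w z)
    flip-cong x≈y = S.trans UV.flip-series (S.trans
      (S.*-congʳ {detSeries A} {crossFactor τ p x} {crossFactor τ p y} (crossFactor-cong {τ} {p} {x} {y} x≈y)) (S.sym flip-series-wz))
      where τ = t· (ℤ.- flipSign a)

    remove-injective : detSeries (remove G u v) S.≈ detSeries (remove G w z) → x S.≈ y
    remove-injective same = cancel (walks-leading u v w z eq) (minorFactor-difference p x y)
      (cancel-det (S.trans (S.sym UV.remove-series) (S.trans same WZ.remove-series)))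

    flip-injective : detSeries (flip G u v) S.≈ detSeries (flip G w z) → x S.≈ y
    -- With τ = ±t the multiplier -τ (2 + τ (x + y)) begins with 2t or -2t, since `x` and `y`
    -- contribute only from t² on.
    flip-injective same = cancel {1} {S.- τ S.* ((S.1# S.+ S.1#) S.+ τ S.* (x S.+ y))}
      ((λ { zero _ → refl ; (suc _) (s≤s ()) }) , second (adj u v))
      (crossFactor-difference τ p x y)
      (cancel-det (S.trans (S.sym UV.flip-series) (S.trans same flip-series-wz)))
      where
      τ = t· (ℤ.- flipSign a)
      second : ∀ b → let τ = t· (ℤ.- flipSign (bit b)) in
               (S.- τ S.* ((S.1# S.+ S.1#) S.+ τ S.* (x S.+ y))) 1 ≢ 0ℤ
      second true  ()
      second false ()

    amalgamate-injective : detSeries (amalgamate G u v) S.≈ detSeries (amalgamate G w z) → x S.≈ y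
    -- The multiplier 2 - (1 - at)(x + y) has constant term 2: no walk of length 0 joins distinct
    -- vertices.
    amalgamate-injective same = cancel {0} {(S.1# S.+ S.1#) S.- e S.* (x S.+ y)}
      (leading₀ λ s₀≡0 → contradiction (trans (sym s₀) s₀≡0) λ ())
      (mergeFactor-difference e p x y)
      (cancel-det (S.trans (S.sym UV.amalgamate-series) (S.trans same amalgamate-series-wz)))
      where
      e = linear 1ℤ (ℤ.- a)
      apart : ∀ u v → u ≢ v → pow A 0 u v ≡ 0ℤ
      apart u v u≢v = pow-no-walk 0 {u} {v} λ { [] → u≢v refl }
      s₀ : + 2 ℤ.- 1ℤ * (pow A 0 u v + pow A 0 w z) ≡ + 2
      s₀ = cong₂ (λ i j → + 2 ℤ.- 1ℤ * (i + j)) (apart u v u≢v) (apart w z w≢z)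

    addPath-injective : detSeries (addPath G u v) S.≈ detSeries (addPath G w z) → x S.≈ y
    -- The multiplier is 2t², of order 2.
    addPath-injective same = cancel {2} {τ S.* τ S.* (S.1# S.+ S.1#)}
      ((λ { zero _ → refl ; (suc zero) _ → refl ; (suc (suc _)) (s≤s (s≤s ())) }) , λ ())
      (frameFactor-difference τ p x y)
      (cancel-det (S.trans (S.sym UV.addPath-series) (S.trans same WZ.addPath-series)))
      where τ = t· (ℤ.- 1ℤ)

    size-equal : length (others u v) ≡ length (others w z)
    size-equal = ℕₚ.suc-injective (ℕₚ.suc-injective (trans UV.size (sym WZ.size)))

  pow⇒series : (∀ k → DistanceConstant (pow A k)) → ∀ u v w z → d u v ≡ d w z → C u v S.≈ C w z
  pow⇒series pow-const u v w z eq k = pow-const k u v w z eq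

  diagonal : (∀ k → DistanceConstant (pow A k)) → ∀ u w → C w w S.≈ C u u
  diagonal pow-const u w = pow⇒series pow-const w w u u (trans (d-refl w) (sym (d-refl u)))

  remove₁-size-equal : ∀ u w → length (others u u) ≡ length (others w w)
  remove₁-size-equal u w = ℕₚ.suc-injective (trans (remove₁-size u) (sym (remove₁-size w)))

  from-diagonal : (∀ u w → C u u S.≈ C w w) →
                  (∀ {u v w z} → u ≢ v → d u v ≡ d w z → C u v S.≈ C w z) →
                  ∀ k → DistanceConstant (pow A k)
  from-diagonal diag off = series⇒pow C-const
    where
    C-const : ∀ u v w z → d u v ≡ d w z → C u v S.≈ C w z
    C-const u v w z eq = go (u ≟ v)
      where
      go : Dec (u ≡ v) → C u v S.≈ C w z
      go (no  u≢v) = off {u} {v} {w} {z} u≢v eq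
      go (yes refl) with d≡0 {w} {z} (trans (sym eq) (d-refl u))
      ... | refl = diag u w

  module _ {c ℓ₁ ℓ₂} (K : AlgClosedFieldChar0 c ℓ₁ ℓ₂) {D : ℕ} (d≤D : ∀ u v → d u v ≤ D) where
    open Spectra K

    distanceRegular⇒cospectral : DistanceRegular G conn → CospectralUpTo K G conn D
    distanceRegular⇒cospectral dr h h≤D u v w z duv dwz = go (u ≟ v)
      where
      pow-const = distanceRegular⇒pow d≤D dr
      eq = trans duv (sym dwz)
      go : Dec (u ≡ v) → SameSpectrum K (remove G u v) (remove G w z)
      go (no u≢v) = detSeries⇒sameSpectrum _ _ size-equal (remove-cong (pow⇒series pow-const u v w z eq))
        where open SameDistance u v w z u≢v eq (diagonal pow-const u)
      go (yes refl) with d≡0 {w} {z} (trans (sym eq) (d-refl u))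
      ... | refl = detSeries⇒sameSpectrum _ _ (remove₁-size-equal u w)
        (S.trans (remove₁-series u) (S.trans
          (S.*-congʳ {detSeries A} {C u u} {C w w} (diagonal pow-const w u)) (S.sym (remove₁-series w))))

    cospectral⇒distanceRegular : CospectralUpTo K G conn D → DistanceRegular G conn
    cospectral⇒distanceRegular cosp = pow⇒distanceRegular (from-diagonal diag λ {u} {v} {w} {z} u≢v eq →
      let open SameDistance u v w z u≢v eq (λ x → diag x u) in
      remove-injective (sameSpectrum⇒detSeries _ _ size-equal (cosp (d u v) (d≤D u v) u v w z refl (sym eq))))
      where
      diag : ∀ u w → C u u S.≈ C w w
      diag u w = remove₁-injective (sameSpectrum⇒detSeries _ _ (remove₁-size-equal u w)
        (cosp 0 z≤n u u w w (d-refl u) (d-refl w)))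

    distanceRegular⇒isospectral : DistanceRegular G conn → IsospectralUpTo K G conn D
    distanceRegular⇒isospectral dr zero h≤D u w = detSeries⇒sameSpectrum _ _ refl
      (S.trans (addLoop-series u) (S.trans (loopFactor-of {c = C u u} {C w w} S.refl
        (diagonal (distanceRegular⇒pow d≤D dr) w u) (t· (ℤ.- 1ℤ))) (S.sym (addLoop-series w))))
    distanceRegular⇒isospectral dr (suc h) h≤D u v w z duv dwz =
      -- One alternative is enough; a flip keeps the vertex set, so the sizes agree by `refl`.
      inj₁ (detSeries⇒sameSpectrum _ _ refl (flip-cong (pow⇒series pow-const u v w z eq)))
      where
      pow-const = distanceRegular⇒pow d≤D dr
      eq = trans duv (sym dwz)
      open SameDistance u v w z (d≢0 u v duv) eq (diagonal pow-const u)

    isospectral⇒distanceRegular : IsospectralUpTo K G conn D → DistanceRegular G conn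
    isospectral⇒distanceRegular iso = pow⇒distanceRegular (from-diagonal diag off)
      where
      diag : ∀ u w → C u u S.≈ C w w
      diag u w = addLoop-injective (sameSpectrum⇒detSeries _ _ refl (iso 0 z≤n u w))
      off : ∀ {u v w z} → u ≢ v → d u v ≡ d w z → C u v S.≈ C w z
      off {u} {v} {w} {z} u≢v eq = go (d u v) refl
        where
        open SameDistance u v w z u≢v eq (λ x → diag x u)
        -- `PunctuallyIsospectral` unfolds only at a successor, hence the case split on the
        -- distance. Whichever alternative holds for these two pairs, it determines the entry of C.
        go : ∀ h → d u v ≡ h → C u v S.≈ C w z
        go zero    duv = contradiction (d≡0 {u} {v} duv) u≢v
        go (suc h) duv with iso (suc h) (subst (_≤ D) duv (d≤D u v)) u v w z duv (trans (sym eq) duv)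
        ... | inj₁ same        = flip-injective (sameSpectrum⇒detSeries _ _ refl same)
        ... | inj₂ (inj₁ same) = amalgamate-injective (sameSpectrum⇒detSeries _ _ (cong suc size-equal) same)
        ... | inj₂ (inj₂ same) = addPath-injective (sameSpectrum⇒detSeries _ _ refl same)

theorem5p2 : ∀ {c ℓ₁ ℓ₂} (K : AlgClosedFieldChar0 c ℓ₁ ℓ₂)
    {n : ℕ} (G : Graph n) (conn : Connected G)
    (D : ℕ) → IsDiameter G conn D →
    (DistanceRegular G conn ⇔ CospectralUpTo K G conn D)
    × (DistanceRegular G conn ⇔ IsospectralUpTo K G conn D)
theorem5p2 K G conn D (d≤D , _) =
    mk⇔ (distanceRegular⇒cospectral K d≤D) (cospectral⇒distanceRegular K d≤D)
  , mk⇔ (distanceRegular⇒isospectral K d≤D) (isospectral⇒distanceRegular K d≤D)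
  where open Characterisation G conn
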